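{- Let $\mathcal{H}(z)=\sum_{n\ge 0} |\mathcal{S}_n\cap Av(\mathbf{4123},\mathbf{1324},\mathbf{31524})|\, z^n$ be the generating function for the permutation class $Av(\mathbf{4123},\mathbf{1324},\mathbf{31524})$. Then $$\mathcal{H}(z) = \frac{3-22z+54z^2-54z^3+25z^4-4z^5-(1-6z+14z^2-16z^3+5z^4)\sqrt{1-4z}}{2\sqrt{1-4z}\,(1-3z+z^2)^2}.$$
   Context: A permutation $\sigma$ contains a pattern $\pi$ if some subsequence of $\sigma$ is order-isomorphic to $\pi$; otherwise $\sigma$ avoids $\pi$. For a set $B$ of patterns, $Av(B)$ is the set of permutations avoiding every element of $B$, and $\mathcal{S}_n$ is the set of permutations of length $n$ (the empty permutation is counted for $n=0$). -}

module Defs where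

open import Data.Bool using (Bool; true; false; _∧_; _∨_; not; if_then_else_)
open import Data.Nat using (ℕ; zero; suc; _<ᵇ_; _≡ᵇ_)
open import Data.Integer using (ℤ; +_; _+_; _*_; _-_; -_)
open import Data.List using (List; []; _∷_; map; filter; length; concatMap; upTo; foldr)
open import Data.Bool.ListAction using (all; any)
open import Relation.Binary.PropositionalEquality using (_≡_)
open import Data.Bool using (T)
open import Relation.Nullary.Decidable using (Dec)
open import Data.Bool.Properties using (T?)

-- Permutations of length n are represented in one-line notation as lists
-- of length n over {0,…,n-1} in which every value occurs.

words : ℕ → ℕ → List (List ℕ)
words k zero    = [] ∷ []
words k (suc m) = concatMap (λ x → map (x ∷_) (words k m)) (upTo k)

elem : ℕ → List ℕ → Bool
elem x = any (λ y → x ≡ᵇ y)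

-- a word of length n over {0,…,n-1} is a permutation iff every value occurs
isPerm : ℕ → List ℕ → Bool
isPerm n w = all (λ i → elem i w) (upTo n)

perms : ℕ → List (List ℕ)
perms n = filter (λ w → T? (isPerm n w)) (words n n)

subseqs : List ℕ → List (List ℕ)
subseqs []       = [] ∷ []
subseqs (x ∷ xs) = map (x ∷_) (subseqs xs) Data.List.++ subseqs xs

sameLen : List ℕ → List ℕ → Bool
sameLen []       []       = true
sameLen (_ ∷ a)  (_ ∷ b)  = sameLen a b
sameLen _        _        = false

headAgree : ℕ → ℕ → List ℕ → List ℕ → Bool
headAgree x y (a ∷ as) (b ∷ bs) =
  ((x <ᵇ a) ≡ᵇᵇ (y <ᵇ b)) ∧ ((a <ᵇ x) ≡ᵇᵇ (b <ᵇ y)) ∧ headAgree x y as bs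
  where
  _≡ᵇᵇ_ : Bool → Bool → Bool
  true  ≡ᵇᵇ q = q
  false ≡ᵇᵇ q = not q
headAgree _ _ _ _ = true

orderIso : List ℕ → List ℕ → Bool
orderIso (x ∷ as) (y ∷ bs) = headAgree x y as bs ∧ orderIso as bs
orderIso []       []       = true
orderIso _        _        = false

contains : List ℕ → List ℕ → Bool
contains σ π = any (λ s → orderIso s π) (subseqs σ)

avoidsAll : List (List ℕ) → List ℕ → Bool
avoidsAll B σ = all (λ π → not (contains σ π)) B

countAv : List (List ℕ) → ℕ → ℕ
countAv B n = length (filter (λ σ → T? (avoidsAll B σ)) (perms n))

basis : List (List ℕ)
basis = (4 ∷ 1 ∷ 2 ∷ 3 ∷ []) ∷ (1 ∷ 3 ∷ 2 ∷ 4 ∷ []) ∷ (3 ∷ 1 ∷ 5 ∷ 2 ∷ 4 ∷ []) ∷ []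

Series : Set
Series = ℕ → ℤ

poly : List ℤ → Series
poly []       n       = + 0
poly (c ∷ cs) zero    = c
poly (c ∷ cs) (suc n) = poly cs n

_⊕_ : Series → Series → Series
(f ⊕ g) n = f n + g n

_⊖_ : Series → Series → Series
(f ⊖ g) n = f n - g n

convAux : Series → Series → ℕ → ℕ → ℤ
convAux f g zero    m = f zero * g m
convAux f g (suc k) m = f (suc k) * g m + convAux f g k (suc m)

_⊛_ : Series → Series → Series
(f ⊛ g) n = convAux f g n 0

infixl 7 _⊛_
infixl 6 _⊕_ _⊖_
infix 4 _≋_

_≋_ : Series → Series → Set
f ≋ g = ∀ n → f n ≡ g n

H : Series
H n = + countAv basis n

module Submission where

-- Build a permutation by appending entries on the right, and call a value position ("site") of a
-- permutation active if a new last entry may be inserted there without creating a forbidden pattern.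
-- Whether a site w > v stays active after inserting v depends only on how the smaller and the larger
-- entries around v are interleaved: all sites survive if one of the two kinds is missing, only the
-- top site if the larger entries all come first, only the site just above v if the smaller entries
-- all come first, none if they are mixed.  The sites w ≤ v always survive.
-- Hence the list of types of the active sites determines the tree of descendants.  The lists
-- that occur form four two-parameter families, whose generating functions satisfy a linear system;
-- its solution is unique because every equation has the form f = 1 + z (…), and it is
-- explicit in terms of the Catalan series C = 1 + z C² and of √(1 - 4z) = 1 - 2 z C.

open import Defs
open import Data.Integer using (ℤ; +_; -_)
open import Data.List using (List; []; _∷_)
open import Relation.Binary.PropositionalEquality using (_≡_)
open import Level using (0ℓ)
open import Algebra.Bundles using (CommutativeRing)
open import Algebra.Solver.Ring.AlmostCommutativeRing using (fromCommutativeRing; _-Raw-AlmostCommutative⟶_)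
import Algebra.Solver.Ring
open import Data.Bool using (Bool; true; false; _∧_; _∨_; not; if_then_else_; T)
open import Data.Bool.ListAction using (all)
open import Data.Bool.Properties using (T?)
open import Data.Empty using (⊥; ⊥-elim)
open import Data.Integer using (_+_; _*_; _-_; +-*-rawRing)
import Data.Integer.Properties as ℤ
open import Data.Integer.Tactic.RingSolver using (solve-∀)
open import Data.List using (_++_; map; replicate; reverse; length; concatMap; upTo; filterᵇ; filter)
import Data.List.Properties as List
open import Data.List.Membership.Propositional using (_∈_; _∉_; lose; find)
import Data.List.Membership.Propositional.Properties as ∈
open import Data.List.Relation.Binary.Pointwise using (Pointwise; []; _∷_)
open import Data.List.Relation.Binary.Sublist.Propositional as Sub using (_⊆_; []; _∷_; _∷ʳ_; ⊆-trans)
open import Data.List.Relation.Binary.Sublist.Propositional.Properties using (reverse⁺; All-resp-⊆)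
open import Data.List.Relation.Unary.All as All using ([]; _∷_)
import Data.List.Relation.Unary.All.Properties as Allₚ
open import Data.List.Relation.Unary.AllPairs using ([]; _∷_)
open import Data.List.Relation.Unary.Any using (here; there)
import Data.List.Relation.Unary.Any.Properties as Any
open import Data.List.Relation.Unary.Unique.Propositional using (Unique)
import Data.List.Relation.Unary.Unique.Propositional.Properties as Unique
open import Data.Maybe.Base using (Maybe; just; nothing)
open import Data.Nat.Base as ℕ using (ℕ; zero; suc; _<_; _≤_; _<ᵇ_; z≤n; s≤s)
import Data.Nat.Properties as ℕ
open import Data.Product using (∃; ∃₂; _×_; _,_; proj₁; proj₂)
open import Data.Sum using (_⊎_; inj₁; inj₂)
open import Function using (_∘_)
open import Relation.Binary.PropositionalEquality using (_≢_; refl; sym; trans; cong; cong₂; subst; module ≡-Reasoning)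
open import Relation.Binary.Structures using (IsEquivalence)
open import Relation.Nullary using (¬_; yes; no)

-- The ring of integer power series

-- All three patterns end in an ascent, so a new last entry `v` endangers only the sites `w` above
-- it. Such a `w` is lost if the earlier entries contain, in this order, `c a` with `a < v` and
-- `w ≤ c` (4123), `a c` with `a < v ≤ c < w` (1324), or `c a d` with `a < v ≤ c < w ≤ d` (31524).
-- The third pattern makes the mixed case uniform: if a smaller entry `a` stands between larger ones
-- `c` and `c′`, then `w ≤ c` gives 4123, `c′ < w` gives 1324, and the gap `c < w ≤ c′` gives 31524.
-- If a larger entry stands between two smaller ones, the two short patterns already exclude every
-- `w`. Hence no heights need to be remembered besides the order of the sites. The indices of the
-- four families grow without bound, so the linear system is infinite; its solution is written down
-- in closed form and compared with the tree coefficient by coefficient. Nothing is divided: each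
-- quotient enters through an equation that it satisfies, and the ring solver is given the multiples
-- of these equations that make an identity hold.

tail : Series → Series
tail f n = f (suc n)

con : ℤ → Series
con c = poly (c ∷ [])

0ₛ 1ₛ z : Series
0ₛ = con (+ 0)
1ₛ = con (+ 1)
z  = poly (+ 0 ∷ + 1 ∷ [])

⊝_ : Series → Series
(⊝ f) n = - f n

convAux-shift : ∀ f g k m → convAux f g k (suc m) ≡ convAux f (tail g) k m
convAux-shift f g zero    m = refl
convAux-shift f g (suc k) m = cong (λ x → f (suc k) * g (suc m) + x) (convAux-shift f g k (suc m))

⊛-sucʳ : ∀ f g n → (f ⊛ g) (suc n) ≡ f (suc n) * g 0 + (f ⊛ tail g) n
⊛-sucʳ f g n = cong (λ x → f (suc n) * g 0 + x) (convAux-shift f g n 0)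

-- `convAux` peels off the highest coefficient of `f`; peeling off the lowest one instead leaves a
-- convolution with `tail f`, and this is the recursion on which the ring laws are proved by
-- induction.
convAux-sucˡ : ∀ f g k m → convAux f g (suc k) m ≡ f 0 * g (m ℕ.+ suc k) + convAux (tail f) g k m
convAux-sucˡ f g zero m rewrite ℕ.+-comm m 1 = ℤ.+-comm (f 1 * g m) (f 0 * g (suc m))
convAux-sucˡ f g (suc k) m
  rewrite convAux-sucˡ f g k (suc m) | ℕ.+-suc m (suc k) =
  lemma (f (suc (suc k)) * g m) (f 0 * g (suc (m ℕ.+ suc k))) (convAux (tail f) g k (suc m))
  where
  lemma : ∀ a b c → a + (b + c) ≡ b + (a + c)
  lemma = solve-∀

⊛-sucˡ : ∀ f g n → (f ⊛ g) (suc n) ≡ f 0 * g (suc n) + (tail f ⊛ g) n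
⊛-sucˡ f g n = convAux-sucˡ f g n 0

convAux-cong : ∀ {f f′ g g′} → f ≋ f′ → g ≋ g′ → ∀ k m → convAux f g k m ≡ convAux f′ g′ k m
convAux-cong p q zero    m = cong₂ _*_ (p 0) (q m)
convAux-cong p q (suc k) m = cong₂ _+_ (cong₂ _*_ (p (suc k)) (q m)) (convAux-cong p q k (suc m))

⊛-cong : ∀ {f f′ g g′} → f ≋ f′ → g ≋ g′ → f ⊛ g ≋ f′ ⊛ g′
⊛-cong p q n = convAux-cong p q n 0

⊛-comm : ∀ f g → f ⊛ g ≋ g ⊛ f
⊛-comm f g zero    = ℤ.*-comm (f 0) (g 0)
⊛-comm f g (suc n) = begin
  (f ⊛ g) (suc n)                    ≡⟨ ⊛-sucˡ f g n ⟩
  f 0 * g (suc n) + (tail f ⊛ g) n   ≡⟨ cong₂ _+_ (ℤ.*-comm (f 0) _) (⊛-comm (tail f) g n) ⟩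
  g (suc n) * f 0 + (g ⊛ tail f) n   ≡⟨ ⊛-sucʳ g f n ⟨
  (g ⊛ f) (suc n)                    ∎
  where open ≡-Reasoning

⊛-distribʳ : ∀ h f g → (f ⊕ g) ⊛ h ≋ f ⊛ h ⊕ g ⊛ h
⊛-distribʳ h f g zero    = ℤ.*-distribʳ-+ (h 0) (f 0) (g 0)
⊛-distribʳ h f g (suc n)
  rewrite ⊛-sucˡ (f ⊕ g) h n | ⊛-sucˡ f h n | ⊛-sucˡ g h n | ⊛-distribʳ h (tail f) (tail g) n =
  lemma (f 0) (g 0) (h (suc n)) ((tail f ⊛ h) n) ((tail g ⊛ h) n)
  where
  lemma : ∀ a b c x y → (a + b) * c + (x + y) ≡ (a * c + x) + (b * c + y)
  lemma = solve-∀

scale-⊛ : ∀ c f g → (λ k → c * f k) ⊛ g ≋ (λ k → c * (f ⊛ g) k)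
scale-⊛ c f g zero    = ℤ.*-assoc c (f 0) (g 0)
scale-⊛ c f g (suc n)
  rewrite ⊛-sucˡ (λ k → c * f k) g n | ⊛-sucˡ f g n | scale-⊛ c (tail f) g n =
  lemma c (f 0) (g (suc n)) ((tail f ⊛ g) n)
  where
  lemma : ∀ a b c x → (a * b) * c + a * x ≡ a * (b * c + x)
  lemma = solve-∀

⊛-assoc : ∀ f g h → f ⊛ g ⊛ h ≋ f ⊛ (g ⊛ h)
⊛-assoc f g h zero    = ℤ.*-assoc (f 0) (g 0) (h 0)
⊛-assoc f g h (suc n) = begin
  (f ⊛ g ⊛ h) (suc n)
    ≡⟨ ⊛-sucˡ (f ⊛ g) h n ⟩
  f 0 * g 0 * h (suc n) + (tail (f ⊛ g) ⊛ h) n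
    ≡⟨ cong (λ x → f 0 * g 0 * h (suc n) + x) (⊛-cong {g = h} (⊛-sucˡ f g) (λ _ → refl) n) ⟩
  f 0 * g 0 * h (suc n) + (((λ k → f 0 * tail g k) ⊕ tail f ⊛ g) ⊛ h) n
    ≡⟨ cong (λ x → f 0 * g 0 * h (suc n) + x) (⊛-distribʳ h (λ k → f 0 * tail g k) (tail f ⊛ g) n) ⟩
  f 0 * g 0 * h (suc n) + (((λ k → f 0 * tail g k) ⊛ h) n + (tail f ⊛ g ⊛ h) n)
    ≡⟨ cong₂ (λ x y → f 0 * g 0 * h (suc n) + (x + y)) (scale-⊛ (f 0) (tail g) h n) (⊛-assoc (tail f) g h n) ⟩
  f 0 * g 0 * h (suc n) + (f 0 * (tail g ⊛ h) n + (tail f ⊛ (g ⊛ h)) n)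
    ≡⟨ lemma (f 0) (g 0) (h (suc n)) ((tail g ⊛ h) n) ((tail f ⊛ (g ⊛ h)) n) ⟩
  f 0 * (g 0 * h (suc n) + (tail g ⊛ h) n) + (tail f ⊛ (g ⊛ h)) n
    ≡⟨ cong (λ x → f 0 * x + (tail f ⊛ (g ⊛ h)) n) (⊛-sucˡ g h n) ⟨
  f 0 * (g ⊛ h) (suc n) + (tail f ⊛ (g ⊛ h)) n
    ≡⟨ ⊛-sucˡ f (g ⊛ h) n ⟨
  (f ⊛ (g ⊛ h)) (suc n) ∎
  where
  open ≡-Reasoning
  lemma : ∀ a b c x y → a * b * c + (a * x + y) ≡ a * (b * c + x) + y
  lemma = solve-∀

0ₛ-coeff : ∀ n → 0ₛ n ≡ + 0
0ₛ-coeff zero    = refl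
0ₛ-coeff (suc n) = refl

const0-⊛ : ∀ f n → ((λ _ → + 0) ⊛ f) n ≡ + 0
const0-⊛ f zero    = refl
const0-⊛ f (suc n) rewrite ⊛-sucˡ (λ _ → + 0) f n = trans (ℤ.+-identityˡ _) (const0-⊛ f n)

con-⊛ : ∀ c f n → (con c ⊛ f) n ≡ c * f n
con-⊛ c f zero    = refl
con-⊛ c f (suc n) rewrite ⊛-sucˡ (con c) f n | const0-⊛ f n = ℤ.+-identityʳ _

⊛-identityˡ : ∀ f → 1ₛ ⊛ f ≋ f
⊛-identityˡ f n = trans (con-⊛ (+ 1) f n) (ℤ.*-identityˡ (f n))

z-⊛-suc : ∀ f n → (z ⊛ f) (suc n) ≡ f n
z-⊛-suc f n rewrite ⊛-sucˡ z f n = trans (ℤ.+-identityˡ _) (⊛-identityˡ f n)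

≋-isEquivalence : IsEquivalence _≋_
≋-isEquivalence = record
  { refl = λ n → refl ; sym = λ p n → sym (p n) ; trans = λ p q n → trans (p n) (q n) }

⊛-⊕-commutativeRing : CommutativeRing 0ℓ 0ℓ
⊛-⊕-commutativeRing = record
  { Carrier = Series ; _≈_ = _≋_ ; _+_ = _⊕_ ; _*_ = _⊛_ ; -_ = ⊝_ ; 0# = 0ₛ ; 1# = 1ₛ
  ; isCommutativeRing = record
    { isRing = record
      { +-isAbelianGroup = record
        { isGroup = record
          { isMonoid = record
            { isSemigroup = record
              { isMagma = record
                { isEquivalence = ≋-isEquivalence
                ; ∙-cong = λ p q n → cong₂ _+_ (p n) (q n) }
              ; assoc = λ f g h n → ℤ.+-assoc (f n) (g n) (h n) }
            ; identity = (λ f n → trans (cong (λ x → x + f n) (0ₛ-coeff n)) (ℤ.+-identityˡ (f n))) ,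
              (λ f n → trans (cong (λ x → f n + x) (0ₛ-coeff n)) (ℤ.+-identityʳ (f n))) }
          ; inverse = (λ f n → trans (ℤ.+-inverseˡ (f n)) (sym (0ₛ-coeff n))) ,
              (λ f n → trans (ℤ.+-inverseʳ (f n)) (sym (0ₛ-coeff n)))
          ; ⁻¹-cong = λ p n → cong -_ (p n) }
        ; comm = λ f g n → ℤ.+-comm (f n) (g n) }
      ; *-cong = ⊛-cong
      ; *-assoc = ⊛-assoc
      ; *-identity = ⊛-identityˡ , λ f n → trans (⊛-comm f 1ₛ n) (⊛-identityˡ f n)
      ; distrib = (λ f g h n → trans (⊛-comm f (g ⊕ h) n) (trans (⊛-distribʳ f g h n)
                     (cong₂ _+_ (⊛-comm g f n) (⊛-comm h f n)))) , ⊛-distribʳ }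
    ; *-comm = ⊛-comm } }

-- With integers as coefficients the solver computes with numerals and decides when they cancel.
con-morphism : +-*-rawRing -Raw-AlmostCommutative⟶ fromCommutativeRing ⊛-⊕-commutativeRing
con-morphism = record
  { ⟦_⟧ = con
  ; +-homo = λ { a b zero → refl ; a b (suc n) → refl }
  ; *-homo = λ a b n → sym (trans (con-⊛ a (con b) n) (con-* a b n))
  ; -‿homo = λ { a zero → refl ; a (suc n) → refl }
  ; 0-homo = λ n → refl
  ; 1-homo = λ n → refl }
  where
  con-* : ∀ a b n → a * con b n ≡ con (a * b) n
  con-* a b zero    = refl
  con-* a b (suc n) = ℤ.*-zeroʳ a

con-≟ : ∀ a b → Maybe (con a ≋ con b)
con-≟ a b with a ℤ.≟ b
... | yes refl = just λ n → refl
... | no _     = nothing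

open Algebra.Solver.Ring +-*-rawRing (fromCommutativeRing ⊛-⊕-commutativeRing) con-morphism con-≟
  using (solve; _:=_; _:+_; _:*_; _:-_; :-_) renaming (con to κ)

infixr 0 _⨾_
_⨾_ : ∀ {f g h} → f ≋ g → g ≋ h → f ≋ h
(p ⨾ q) n = trans (p n) (q n)

open CommutativeRing ⊛-⊕-commutativeRing using ()
  renaming (refl to ≋-refl; sym to ≋-sym; trans to ≋-trans; +-cong to ⊕-cong)

-- Identities modulo relations g ≋ h: the ring solver checks them with explicit cofactors k,
-- and the extra terms are then dropped one at a time.
⊕-vanish : ∀ {f g h} k → g ≋ h → f ⊕ k ⊛ (g ⊖ h) ≋ f
⊕-vanish {f} {g} {h} k g≋h = ≋-trans
  (⊕-cong {f} ≋-refl (⊛-cong {k} ≋-refl λ n → trans (cong (_- h n) (g≋h n)) (trans (ℤ.+-inverseʳ (h n)) (sym (0ₛ-coeff n)))))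
  (solve 2 (λ f k → f :+ k :* κ (+ 0) := f) ≋-refl f k)

fixpoint-z : ∀ f → f 0 ≡ + 1 → ∀ g → (∀ n → f (suc n) ≡ g n) → f ≋ 1ₛ ⊕ z ⊛ g
fixpoint-z f f0 g p zero    = f0
fixpoint-z f f0 g p (suc n) = trans (p n) (sym (trans (ℤ.+-identityˡ _) (z-⊛-suc g n)))

-- The powers of the Catalan series, from C^(k+1) = C^k + z C^(k+2); this recursion needs no convolution.
catPow : ℕ → Series
catPow zero    n       = 1ₛ n
catPow (suc k) zero    = + 1
catPow (suc k) (suc n) = catPow k (suc n) + catPow (suc (suc k)) n

catPow-suc : ∀ k → catPow (suc k) ≋ catPow k ⊕ z ⊛ catPow (suc (suc k))
catPow-suc zero    zero    = refl
catPow-suc (suc k) zero    = refl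
catPow-suc k       (suc n) = cong (λ x → catPow k (suc n) + x) (sym (z-⊛-suc (catPow (suc (suc k))) n))

-- The recursion either lowers the exponent `k` at the same coefficient or raises it at an earlier
-- coefficient, so the induction is lexicographic in `n` and then `k`.
catalan-recursion-unique : (f g : ℕ → Series) → f 0 ≋ g 0 →
  (∀ k → f (suc k) ≋ f k ⊕ z ⊛ f (suc (suc k))) → (∀ k → g (suc k) ≋ g k ⊕ z ⊛ g (suc (suc k))) →
  ∀ n k → f k n ≡ g k n
catalan-recursion-unique f g base fs gs n zero = base n
catalan-recursion-unique f g base fs gs zero (suc k) =
  trans (fs k 0) (trans (cong (λ x → x + + 0) (catalan-recursion-unique f g base fs gs 0 k)) (sym (gs k 0)))
catalan-recursion-unique f g base fs gs (suc n) (suc k) =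
  trans (fs k (suc n)) (trans
    (cong₂ _+_ (catalan-recursion-unique f g base fs gs (suc n) k)
      (trans (z-⊛-suc (f (2 ℕ.+ k)) n) (trans (catalan-recursion-unique f g base fs gs n (2 ℕ.+ k))
        (sym (z-⊛-suc (g (2 ℕ.+ k)) n)))))
    (sym (gs k (suc n))))

C : Series
C = catPow 1

-- The recursion is linear, so multiplication by `C` gives another solution, with the same start as
-- the shifted sequence. The case `k = 1` turns the recursion into the quadratic equation of `C`.
catPow-⊛ : ∀ k → catPow (suc k) ≋ catPow k ⊛ C
catPow-⊛ k n = sym (catalan-recursion-unique (λ k → catPow k ⊛ C) (λ k → catPow (suc k))
  (⊛-identityˡ C)
  (λ k → ≋-trans (⊛-cong (catPow-suc k) ≋-refl)
    (solve 4 (λ f g z c → (f :+ z :* g) :* c := f :* c :+ z :* (g :* c)) ≋-refl (catPow k) (catPow (2 ℕ.+ k)) z C))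
  (λ k → catPow-suc (suc k)) n k)

C-eq : C ≋ 1ₛ ⊕ z ⊛ (C ⊛ C)
C-eq = ≋-trans (catPow-suc 0) (⊕-cong {1ₛ} ≋-refl (⊛-cong {z} ≋-refl (catPow-⊛ 1)))

-- Auxiliary rational series, telescoping sums and the equations of the constants

geom : ℤ → Series
geom a zero    = + 1
geom a (suc n) = a * geom a n

geom-eq : ∀ a → geom a ≋ 1ₛ ⊕ z ⊛ (con a ⊛ geom a)
geom-eq a = fixpoint-z (geom a) refl (con a ⊛ geom a) (λ n → sym (con-⊛ a (geom a) n))

q : Series
q zero          = + 1
q (suc zero)    = + 3
q (suc (suc n)) = + 3 * q (suc n) - q n

q-eq : q ≋ 1ₛ ⊕ z ⊛ (con (+ 3) ⊛ q ⊖ z ⊛ q)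
q-eq = fixpoint-z q refl _ λ
  { zero → refl
  ; (suc n) → cong₂ _-_ (sym (con-⊛ (+ 3) q (suc n))) (sym (z-⊛-suc q n)) }

Σₛ : ℕ → (ℕ → Series) → Series
Σₛ zero    f = 0ₛ
Σₛ (suc n) f = f 0 ⊕ Σₛ n (λ i → f (suc i))

-- The sums over children occur with the factor `z`, and with it the summands become differences
-- without any division, as in z C^(m+2) = C^(m+1) - C^m.
Σₛ-telescope : ∀ (f g : ℕ → Series) → (∀ i → z ⊛ f i ≋ g (suc i) ⊖ g i) → ∀ n → z ⊛ Σₛ n f ≋ g n ⊖ g 0
Σₛ-telescope f g p zero    = solve 2 (λ z a → z :* κ (+ 0) := a :- a) ≋-refl z (g 0)
Σₛ-telescope f g p (suc n) = ≋-trans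
  (solve 3 (λ z a b → z :* (a :+ b) := z :* a :+ z :* b) ≋-refl z (f 0) (Σₛ n (λ i → f (suc i))))
  (≋-trans (⊕-cong (p 0) (Σₛ-telescope (λ i → f (suc i)) (λ i → g (suc i)) (λ i → p (suc i)) n))
    (solve 3 (λ a b c → (b :- a) :+ (c :- b) := c :- a) ≋-refl (g 0) (g 1) (g (suc n))))

√1-4z : Series
√1-4z = 1ₛ ⊖ con (+ 2) ⊛ z ⊛ C

-- geom (+ 2) is 1/(1-2z), q is 1/(1-3z+z²), and √1-4z⁻¹ comes from 1/(1-4z).  The other constants are the
-- coefficients found by solving the linear system for the four families below.
ρ ε b δ γ λₛ √1-4z⁻¹ : Series
ρ = (1ₛ ⊖ z) ⊛ geom (+ 2)
ε = (C ⊖ 1ₛ) ⊛ (C ⊖ 1ₛ) ⊛ geom (+ 2)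
b = q ⊛ (1ₛ ⊖ z) ⊛ (C ⊖ 1ₛ) ⊛ (C ⊖ 1ₛ)
√1-4z⁻¹ = √1-4z ⊛ geom (+ 4)
δ = √1-4z⁻¹ ⊛ z ⊛ (C ⊛ C ⊕ b)
γ = q ⊛ z ⊛ (1ₛ ⊖ z) ⊛ (C ⊖ 1ₛ) ⊛ δ
λₛ = q ⊛ z ⊛ z ⊛ (C ⊖ 1ₛ) ⊛ δ

-- Subtracting the equations of family Z for `k` and `k + 1` leaves, apart from the inhomogeneous
-- terms, (1 - 2z) Z(k+1) = (1 - z) Z(k); `ρ` is the resulting ratio.
ρ-eq : ρ ≋ 1ₛ ⊕ z ⊛ (con (+ 2) ⊛ ρ ⊖ 1ₛ)
ρ-eq = ≋-trans
  (solve 2 (λ z d → (κ (+ 1) :- z) :* d :=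
    (κ (+ 1) :+ z :* (κ (+ 2) :* ((κ (+ 1) :- z) :* d) :- κ (+ 1)))
    :+ (κ (+ 1) :- z) :* (d :- (κ (+ 1) :+ z :* (κ (+ 2) :* d)))) ≋-refl z (geom (+ 2)))
  (⊕-vanish (1ₛ ⊖ z) (geom-eq (+ 2)))

ε-eq : ε ≋ con (+ 2) ⊛ z ⊛ ε ⊕ (C ⊖ 1ₛ) ⊛ (C ⊖ 1ₛ)
ε-eq = ≋-trans
  (solve 3 (λ z d e → e :* d := (κ (+ 2) :* z :* (e :* d) :+ e)
    :+ e :* (d :- (κ (+ 1) :+ z :* (κ (+ 2) :* d)))) ≋-refl z (geom (+ 2)) ((C ⊖ 1ₛ) ⊛ (C ⊖ 1ₛ)))
  (⊕-vanish ((C ⊖ 1ₛ) ⊛ (C ⊖ 1ₛ)) (geom-eq (+ 2)))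

b-eq : b ≋ (1ₛ ⊖ z) ⊛ ε ⊕ z ⊛ (ρ ⊛ b)
b-eq = ≋-trans
  (solve 4 (λ z d q e → let o = κ (+ 1) :- z in
    q :* o :* e :* e :=
    (o :* (e :* e :* d) :+ z :* ((o :* d) :* (q :* o :* e :* e)))
    :+ (o :* e :* e :* d) :* (q :- (κ (+ 1) :+ z :* (κ (+ 3) :* q :- z :* q)))
    :+ (:- (o :* e :* e :* q)) :* (d :- (κ (+ 1) :+ z :* (κ (+ 2) :* d)))) ≋-refl z (geom (+ 2)) q (C ⊖ 1ₛ))
  (≋-trans (⊕-vanish _ (geom-eq (+ 2))) (⊕-vanish _ q-eq))

√1-4z-squared : √1-4z ⊛ √1-4z ≋ 1ₛ ⊖ con (+ 4) ⊛ z
√1-4z-squared = ≋-trans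
  (solve 2 (λ z c → (κ (+ 1) :- κ (+ 2) :* z :* c) :* (κ (+ 1) :- κ (+ 2) :* z :* c) :=
    (κ (+ 1) :- κ (+ 4) :* z) :+ (:- (κ (+ 4) :* z)) :* (c :- (κ (+ 1) :+ z :* (c :* c)))) ≋-refl z C)
  (⊕-vanish _ C-eq)

√1-4z⁻¹-eq : √1-4z⁻¹ ≋ 1ₛ ⊕ con (+ 2) ⊛ z ⊛ C ⊛ √1-4z⁻¹
√1-4z⁻¹-eq = ≋-trans
  (solve 3 (λ z c f → let s = κ (+ 1) :- κ (+ 2) :* z :* c in
    s :* f := (κ (+ 1) :+ κ (+ 2) :* z :* c :* (s :* f))
      :+ f :* (s :* s :- (κ (+ 1) :- κ (+ 4) :* z))
      :+ κ (+ 1) :* (f :- (κ (+ 1) :+ z :* (κ (+ 4) :* f)))) ≋-refl z C (geom (+ 4)))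
  (≋-trans (⊕-vanish _ (geom-eq (+ 4))) (⊕-vanish _ √1-4z-squared))

-- `δ-eq`, `λ-eq` and `γ-eq` are what the coefficients of C^(i+j), `ι i` and 1 demand in the
-- equation of family U; `b-eq` is what the coefficient of C^j `h k` demands in family Y.
δ-eq : δ ≋ z ⊛ (con (+ 2) ⊛ C ⊛ δ ⊕ C ⊛ C ⊕ b)
δ-eq = ≋-trans
  (solve 4 (λ z c s e → s :* z :* e := z :* (κ (+ 2) :* c :* (s :* z :* e) :+ e)
    :+ z :* e :* (s :- (κ (+ 1) :+ κ (+ 2) :* z :* c :* s))) ≋-refl z C √1-4z⁻¹ (C ⊛ C ⊕ b))
  (≋-trans (⊕-vanish _ √1-4z⁻¹-eq)
    (solve 4 (λ z t u v → z :* (t :+ (u :+ v)) := z :* (t :+ u :+ v)) ≋-refl z (con (+ 2) ⊛ C ⊛ δ) (C ⊛ C) b))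

λ-eq : λₛ ≋ z ⊛ (λₛ ⊕ γ)
λ-eq = solve 4 (λ z q e δ → q :* z :* z :* e :* δ := z :* (q :* z :* z :* e :* δ :+ q :* z :* (κ (+ 1) :- z) :* e :* δ))
  ≋-refl z q (C ⊖ 1ₛ) δ

γ-eq : γ ≋ z ⊛ (con (+ 2) ⊛ γ ⊕ λₛ ⊕ δ ⊛ (C ⊖ 1ₛ))
γ-eq = ≋-trans
  (solve 4 (λ z q e δ → q :* z :* (κ (+ 1) :- z) :* e :* δ :=
    z :* (κ (+ 2) :* (q :* z :* (κ (+ 1) :- z) :* e :* δ) :+ q :* z :* z :* e :* δ :+ δ :* e)
    :+ z :* δ :* e :* (q :- (κ (+ 1) :+ z :* (κ (+ 3) :* q :- z :* q)))) ≋-refl z q (C ⊖ 1ₛ) δ)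
  (⊕-vanish _ q-eq)

-- Generating functions of the four families

-- Powers as products, so that the ring solver can treat `C^ (suc k)` as `C^ k ⊛ C`; `catPow` serves
-- to construct `C` and its equation.
C^ : ℕ → Series
C^ zero    = 1ₛ
C^ (suc k) = C^ k ⊛ C

C^-+ : ∀ j k → C^ (j ℕ.+ k) ≋ C^ j ⊛ C^ k
C^-+ zero    k = ≋-sym (⊛-identityˡ (C^ k))
C^-+ (suc j) k = ⊛-cong (C^-+ j k) ≋-refl
  ⨾ solve 3 (λ a b c → a :* b :* c := a :* c :* b) ≋-refl (C^ j) (C^ k) C

ι : ℕ → Series
ι zero    = 0ₛ
ι (suc n) = 1ₛ ⊕ ι n

-- h k is the sum of ρ^i C^j over i + j = k - 1.
h : ℕ → Series
h zero    = 0ₛ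
h (suc k) = ρ ⊛ h k ⊕ C^ k

-- The families of lists of site types are (see SiteType, word₁ and word₂ below):
-- X i j = bot abⁱ mixʲ,  U i j = bot abⁱ mixʲ top,  Y j k = bot mixʲ baᵏ top,  Z j k = bot mixʲ baᵏ mix.
valX valU valY valZ : ℕ → ℕ → Series
valX i j = C^ j ⊛ C^ i ⊛ C
valU i j = C^ j ⊛ C^ i ⊛ C ⊕ γ ⊕ δ ⊛ (C^ j ⊛ C^ i) ⊕ λₛ ⊛ ι i ⊕ δ ⊛ (C^ i ⊖ 1ₛ)
valY j k = C^ j ⊛ C^ k ⊛ C ⊕ γ ⊕ δ ⊛ (C^ j ⊛ C^ k) ⊕ C^ j ⊛ b ⊛ h k
valZ j k = C^ j ⊛ C^ k ⊛ C ⊛ C ⊕ C^ j ⊛ ε ⊛ h k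

z⊛valX : ∀ m → z ⊛ valX 0 (suc m) ≋ C^ (suc m) ⊖ C^ m
z⊛valX m = solve 3 (λ z c p → z :* (p :* c :* κ (+ 1) :* c) :=
    (p :* c :- p) :+ (:- p) :* (c :- (κ (+ 1) :+ z :* (c :* c)))) ≋-refl z C (C^ m)
  ⨾ ⊕-vanish _ C-eq

ΣX0 : ∀ j → z ⊛ Σₛ j (λ q → valX 0 (suc q)) ≋ C^ j ⊖ 1ₛ
ΣX0 = Σₛ-telescope (λ q → valX 0 (suc q)) C^ z⊛valX

ΣX : ∀ i j → z ⊛ Σₛ j (λ q → valX 0 (suc (q ℕ.+ i))) ≋ C^ j ⊛ C^ i ⊖ C^ i
ΣX i j = Σₛ-telescope (λ q → valX 0 (suc (q ℕ.+ i))) (λ q → C^ (q ℕ.+ i)) (λ q → z⊛valX (q ℕ.+ i)) j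
  ⨾ λ n → cong (_- C^ i n) (C^-+ j i n)

-- The factor 1 - z C is the inverse of `C`, so the `δ` term of the telescoping sequence is δ
-- C^(p-1), written without a negative exponent.
ΣU : ∀ i → z ⊛ Σₛ i (λ p → valU 0 (suc p)) ≋
  (C^ i ⊕ δ ⊛ (1ₛ ⊖ z ⊛ C) ⊛ C^ i ⊕ z ⊛ γ ⊛ ι i) ⊖ (1ₛ ⊕ δ ⊛ (1ₛ ⊖ z ⊛ C) ⊛ 1ₛ ⊕ z ⊛ γ ⊛ 0ₛ)
ΣU = Σₛ-telescope (λ p → valU 0 (suc p)) (λ p → C^ p ⊕ δ ⊛ (1ₛ ⊖ z ⊛ C) ⊛ C^ p ⊕ z ⊛ γ ⊛ ι p) λ p →
  solve 7 (λ z c g d l x i → let o = κ (+ 1) in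
    z :* (x :* c :* o :* c :+ g :+ d :* (x :* c :* o) :+ l :* κ (+ 0) :+ d :* (o :- o)) :=
    ((x :* c :+ d :* (o :- z :* c) :* (x :* c) :+ z :* g :* (o :+ i)) :- (x :+ d :* (o :- z :* c) :* x :+ z :* g :* i))
    :+ (:- (x :+ d :* x)) :* (c :- (o :+ z :* (c :* c)))) ≋-refl z C γ δ λₛ (C^ p) (ι p)
  ⨾ ⊕-vanish _ C-eq

-- The equation of family Z solved for its sum over `k`, with the terms that do not depend on `k`
-- dropped; the subtracted power is `valX 1 (suc (j + k))`.
telZ : ℕ → ℕ → Series
telZ j k = (1ₛ ⊖ z) ⊛ valZ j k ⊖ z ⊛ (C^ j ⊛ C^ k ⊛ C ⊛ C ⊛ C)

ΣZ : ∀ j k → z ⊛ Σₛ k (λ r → valZ j (suc r)) ≋ telZ j k ⊖ telZ j 0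
ΣZ j = Σₛ-telescope (λ r → valZ j (suc r)) (telZ j) λ r →
  solve 7 (λ z c e r p x h → let o = κ (+ 1)
                                 Z = p :* x :* c :* c :+ p :* e :* h
                                 Z′ = p :* (x :* c) :* c :* c :+ p :* e :* (r :* h :+ x) in
    z :* Z′ :=
    (((o :- z) :* Z′ :- z :* (p :* (x :* c) :* c :* c :* c)) :- ((o :- z) :* Z :- z :* (p :* x :* c :* c :* c)))
    :+ (:- (p :* x :* (c :* c :+ c :- o))) :* (c :- (o :+ z :* (c :* c)))
    :+ (:- (p :* x)) :* (e :- (κ (+ 2) :* z :* e :+ (c :- o) :* (c :- o)))
    :+ (:- (p :* e :* h)) :* (r :- (o :+ z :* (κ (+ 2) :* r :- o)))) ≋-refl z C ε ρ (C^ j) (C^ r) (h r)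
  ⨾ ⊕-vanish _ ρ-eq ⨾ ⊕-vanish _ ε-eq ⨾ ⊕-vanish _ C-eq

-- Family X is the Catalan tree: a word with `m = i + j + 1` sites has children with 2, 3, ..., m +
-- 1 sites, all in X again, whence the value C^m.
X-eq : ∀ i j → valX i j ≋ 1ₛ ⊕ z ⊛ (valX (suc i) j ⊕
  (Σₛ i (λ p → valX 0 (suc p)) ⊕ Σₛ j (λ q → valX 0 (suc (q ℕ.+ i)))))
X-eq i j =
  solve 6 (λ z c x y s t → let o = κ (+ 1) in
    y :* x :* c := (o :+ z :* (y :* (x :* c) :* c :+ (s :+ t)))
    :+ (y :* x) :* (c :- (o :+ z :* (c :* c)))
    :+ (:- o) :* (z :* s :- (x :- o))
    :+ (:- o) :* (z :* t :- (y :* x :- x))) ≋-refl z C (C^ i) (C^ j) (Σₛ i (λ p → valX 0 (suc p)))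
      (Σₛ j (λ q → valX 0 (suc (q ℕ.+ i))))
  ⨾ ⊕-vanish _ (ΣX i j) ⨾ ⊕-vanish _ (ΣX0 i) ⨾ ⊕-vanish _ C-eq

U-eq : ∀ i j → valU i j ≋ 1ₛ ⊕ z ⊛ (valU (suc i) j ⊕
  (Σₛ i (λ p → valU 0 (suc p)) ⊕ (Σₛ j (λ q → valX 0 (suc (q ℕ.+ i))) ⊕ valY (j ℕ.+ i) 1)))
U-eq i j =
  solve 13 (λ z c g d l b r n x y w s t → let o = κ (+ 1) in
    y :* x :* c :+ g :+ d :* (y :* x) :+ l :* n :+ d :* (x :- o) :=
    (o :+ z :* ((y :* (x :* c) :* c :+ g :+ d :* (y :* (x :* c)) :+ l :* (o :+ n) :+ d :* (x :* c :- o))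
      :+ (s :+ (t :+ (w :* (o :* c) :* c :+ g :+ d :* (w :* (o :* c)) :+ w :* b :* (r :* κ (+ 0) :+ o))))))
    :+ (y :* x) :* (c :- (o :+ z :* (c :* c)))
    :+ n :* (l :- z :* (l :+ g))
    :+ o :* (g :- z :* (κ (+ 2) :* g :+ l :+ d :* (c :- o)))
    :+ (y :* x) :* (d :- z :* (κ (+ 2) :* c :* d :+ c :* c :+ b))
    :+ (:- o) :* (z :* s :- ((x :+ d :* (o :- z :* c) :* x :+ z :* g :* n) :- (o :+ d :* (o :- z :* c) :* o :+ z :* g :* κ (+ 0))))
    :+ (:- o) :* (z :* t :- (y :* x :- x))
    :+ (:- (z :* (c :* c :+ d :* c :+ b))) :* (w :- y :* x))
    ≋-refl z C γ δ λₛ b ρ (ι i) (C^ i) (C^ j) (C^ (j ℕ.+ i)) (Σₛ i (λ p → valU 0 (suc p)))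
      (Σₛ j (λ q → valX 0 (suc (q ℕ.+ i))))
  ⨾ ⊕-vanish _ (C^-+ j i) ⨾ ⊕-vanish _ (ΣX i j) ⨾ ⊕-vanish _ (ΣU i)
  ⨾ ⊕-vanish _ δ-eq ⨾ ⊕-vanish _ γ-eq ⨾ ⊕-vanish _ λ-eq ⨾ ⊕-vanish _ C-eq

Z-eq : ∀ j k → valZ j k ≋ 1ₛ ⊕ z ⊛ (valX 1 (suc (j ℕ.+ k)) ⊕
  (Σₛ j (λ q → valX 0 (suc q)) ⊕ (Σₛ k (λ r → valZ j (suc r)) ⊕ valZ j k)))
Z-eq j k =
  solve 9 (λ z c e y x w h s t → let o = κ (+ 1)
                                     Z = y :* x :* c :* c :+ y :* e :* h
                                     Z₀ = y :* o :* c :* c :+ y :* e :* κ (+ 0) in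
    Z := (o :+ z :* (w :* c :* (o :* c) :* c :+ (s :+ (t :+ Z))))
    :+ (y :* (o :+ c)) :* (c :- (o :+ z :* (c :* c)))
    :+ (:- o) :* (z :* s :- (y :- o))
    :+ (:- o) :* (z :* t :- (((o :- z) :* Z :- z :* (y :* x :* c :* c :* c)) :- ((o :- z) :* Z₀ :- z :* (y :* o :* c :* c :* c))))
    :+ (:- (z :* (c :* c :* c))) :* (w :- y :* x))
    ≋-refl z C ε (C^ j) (C^ k) (C^ (j ℕ.+ k)) (h k) (Σₛ j (λ q → valX 0 (suc q))) (Σₛ k (λ r → valZ j (suc r)))
  ⨾ ⊕-vanish _ (C^-+ j k) ⨾ ⊕-vanish _ (ΣZ j k) ⨾ ⊕-vanish _ (ΣX0 j) ⨾ ⊕-vanish _ C-eq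

Y-eq : ∀ j k → valY j k ≋ 1ₛ ⊕ z ⊛ (valU 1 (j ℕ.+ k) ⊕
  (Σₛ j (λ q → valX 0 (suc q)) ⊕ (Σₛ k (λ r → valZ j (suc r)) ⊕ valY j (suc k))))
Y-eq j k =
  solve 14 (λ z c e g d l b r y x w h s t → let o = κ (+ 1)
                                                Z = y :* x :* c :* c :+ y :* e :* h
                                                Z₀ = y :* o :* c :* c :+ y :* e :* κ (+ 0)
                                                v = w :* (o :* c) in
    y :* x :* c :+ g :+ d :* (y :* x) :+ y :* b :* h :=
    (o :+ z :* ((v :* c :+ g :+ d :* v :+ l :* (o :+ κ (+ 0)) :+ d :* (o :* c :- o))
      :+ (s :+ (t :+ (y :* (x :* c) :* c :+ g :+ d :* (y :* (x :* c)) :+ y :* b :* (r :* h :+ x))))))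
    :+ (y :* (o :+ c) :- y :* x :* c) :* (c :- (o :+ z :* (c :* c)))
    :+ o :* (g :- z :* (κ (+ 2) :* g :+ l :+ d :* (c :- o)))
    :+ (y :* x) :* (d :- z :* (κ (+ 2) :* c :* d :+ c :* c :+ b))
    :+ (y :* h) :* (b :- ((o :- z) :* e :+ z :* (r :* b)))
    :+ (:- o) :* (z :* s :- (y :- o))
    :+ (:- o) :* (z :* t :- (((o :- z) :* Z :- z :* (y :* x :* c :* c :* c)) :- ((o :- z) :* Z₀ :- z :* (y :* o :* c :* c :* c))))
    :+ (:- (z :* (c :* c :+ d :* c))) :* (w :- y :* x))
    ≋-refl z C ε γ δ λₛ b ρ (C^ j) (C^ k) (C^ (j ℕ.+ k)) (h k)
      (Σₛ j (λ q → valX 0 (suc q))) (Σₛ k (λ r → valZ j (suc r)))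
  ⨾ ⊕-vanish _ (C^-+ j k) ⨾ ⊕-vanish _ (ΣZ j k) ⨾ ⊕-vanish _ (ΣX0 j)
  ⨾ ⊕-vanish _ b-eq ⨾ ⊕-vanish _ δ-eq ⨾ ⊕-vanish _ γ-eq ⨾ ⊕-vanish _ C-eq

-- The tree of site types

-- How the entries above and below a site are interleaved: none at all, all above, all below,
-- first those above and then those below, the reverse of that, or neither.
data SiteType : Set where
  emp bot top ab ba mix : SiteType

-- The type after appending an entry lower, respectively higher, than the site.
low high : SiteType → SiteType
low emp = top
low bot = ab
low top = top
low ab  = ab
low ba  = mix
low mix = mix
high emp = bot
high bot = bot
high top = ba
high ab  = mix
high ba  = ba
high mix = mix

isTop : SiteType → Bool
isTop emp = true
isTop top = true
isTop _   = false

-- The part of the new list from the inserted entry upwards: it splits the chosen site in two, and the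
-- types ts of the active sites above it are kept or lost according to the type of the chosen site.
grow : SiteType → List SiteType → List SiteType
grow emp ts = bot ∷ map low (emp ∷ ts)
grow bot ts = bot ∷ map low (bot ∷ ts)
grow top ts = ba ∷ map low (top ∷ ts)
grow ab  ts = mix ∷ map low (filterᵇ isTop ts)
grow ba  ts = ba ∷ mix ∷ []
grow mix ts = mix ∷ []

-- `pre` holds the active sites below the chosen one; they all stay active and see the new entry as
-- a higher one.
total : (List SiteType → ℤ) → List SiteType → List SiteType → ℤ
total f pre []       = + 0
total f pre (t ∷ ts) = f (map high pre ++ grow t ts) + total f (pre ++ t ∷ []) ts

cnt : List SiteType → Series
cnt ts zero    = + 1
cnt ts (suc n) = total (λ us → cnt us n) [] ts

Σℤ : ℕ → (ℕ → ℤ) → ℤ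
Σℤ zero    f = + 0
Σℤ (suc n) f = f 0 + Σℤ n (λ i → f (suc i))

Σℤ-cong : ∀ {f g} → (∀ i → f i ≡ g i) → ∀ n → Σℤ n f ≡ Σℤ n g
Σℤ-cong p zero    = refl
Σℤ-cong p (suc n) = cong₂ _+_ (p 0) (Σℤ-cong (λ i → p (suc i)) n)

Σₛ-coeff : ∀ m f n → Σₛ m f n ≡ Σℤ m (λ i → f i n)
Σₛ-coeff zero    f n = 0ₛ-coeff n
Σₛ-coeff (suc m) f n = cong (λ x → f 0 n + x) (Σₛ-coeff m (λ i → f (suc i)) n)

-- Every member of a run grows the same tail `g`: for `ab` because only top sites survive above it,
-- for `mix` and `ba` because no other site above survives.
total-replicate : ∀ f t rest g → (∀ m → grow t (replicate m t ++ rest) ≡ g) → ∀ k pre →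
  total f pre (replicate k t ++ rest) ≡
  Σℤ k (λ p → f (map high (pre ++ replicate p t) ++ g)) + total f (pre ++ replicate k t) rest
total-replicate f t rest g e zero pre
  rewrite List.++-identityʳ pre = sym (ℤ.+-identityˡ _)
total-replicate f t rest g e (suc k) pre = begin
  f (map high pre ++ grow t (replicate k t ++ rest)) + total f (pre ++ t ∷ []) (replicate k t ++ rest)
    ≡⟨ cong₂ (λ x y → f (map high x ++ y) + total f (pre ++ t ∷ []) (replicate k t ++ rest)) (sym (List.++-identityʳ pre)) (e k) ⟩
  F 0 + total f (pre ++ t ∷ []) (replicate k t ++ rest)
    ≡⟨ cong (λ x → F 0 + x) (total-replicate f t rest g e k (pre ++ t ∷ [])) ⟩
  F 0 + (Σℤ k (λ p → f (map high ((pre ++ t ∷ []) ++ replicate p t) ++ g)) + total f ((pre ++ t ∷ []) ++ replicate k t) rest)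
    ≡⟨ cong₂ (λ x y → F 0 + (x + total f y rest))
         (Σℤ-cong (λ p → cong (λ x → f (map high x ++ g)) (List.++-assoc pre (t ∷ []) (replicate p t))) k)
         (List.++-assoc pre (t ∷ []) (replicate k t)) ⟩
  F 0 + (Σℤ k (λ p → F (suc p)) + total f (pre ++ replicate (suc k) t) rest)
    ≡⟨ ℤ.+-assoc (F 0) _ _ ⟨
  F 0 + Σℤ k (λ p → F (suc p)) + total f (pre ++ replicate (suc k) t) rest ∎
  where
  open ≡-Reasoning
  F = λ p → f (map high (pre ++ replicate p t) ++ g)

module _ {A : Set} where
  replicate-snoc : ∀ k (t : A) ts → replicate k t ++ t ∷ ts ≡ t ∷ replicate k t ++ ts
  replicate-snoc zero    t ts = refl
  replicate-snoc (suc k) t ts = cong (t ∷_) (replicate-snoc k t ts)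

  replicate-+ : ∀ j k (t : A) ts → replicate k t ++ replicate j t ++ ts ≡ replicate (j ℕ.+ k) t ++ ts
  replicate-+ zero    k t ts = refl
  replicate-+ (suc j) k t ts = trans (replicate-snoc k t (replicate j t ++ ts)) (cong (t ∷_) (replicate-+ j k t ts))

map-segment : ∀ (f : SiteType → SiteType) k t us → map f (replicate k t ++ us) ≡ replicate k (f t) ++ map f us
map-segment f k t us = trans (List.map-++ f (replicate k t) us) (cong (_++ map f us) (List.map-replicate f k t))

word₁ word₂ : ℕ → ℕ → List SiteType → List SiteType
word₁ i j ts = bot ∷ replicate i ab ++ replicate j mix ++ ts
word₂ j k ts = bot ∷ replicate j mix ++ replicate k ba ++ ts

grow-ab : ∀ j ts → map low (filterᵇ isTop ts) ≡ ts → ∀ m →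
  grow ab (replicate m ab ++ replicate j mix ++ ts) ≡ mix ∷ ts
grow-ab j       ts e (suc m) = grow-ab j ts e m
grow-ab (suc j) ts e zero    = grow-ab j ts e zero
grow-ab zero    ts e zero    = cong (mix ∷_) e

module _ (f : List SiteType → ℤ) where

  -- Both tails in use, `[]` and `top ∷ []`, satisfy the hypotheses: a top site survives an
  -- insertion at an `ab` site and remains top after a lower entry.
  total-word₁ : ∀ i j ts → map low ts ≡ ts → map low (filterᵇ isTop ts) ≡ ts → total f [] (word₁ i j ts) ≡
    f (word₁ (suc i) j ts) + (Σℤ i (λ p → f (word₁ 0 (suc p) ts)) + (Σℤ j (λ q → f (word₁ 0 (suc (q ℕ.+ i)) []))
      + total f (bot ∷ replicate i ab ++ replicate j mix) ts))
  total-word₁ i j ts e₁ e₂ = cong₂ _+_ (cong (λ x → f (bot ∷ ab ∷ x)) bottom)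
    (trans (total-replicate f ab (replicate j mix ++ ts) (mix ∷ ts) (grow-ab j ts e₂) i (bot ∷ []))
      (cong₂ _+_ (Σℤ-cong (λ p → cong f (first p)) i)
        (trans (total-replicate f mix ts (mix ∷ []) (λ m → refl) j (bot ∷ replicate i ab))
          (cong (λ x → x + total f (bot ∷ replicate i ab ++ replicate j mix) ts) (Σℤ-cong (λ q → cong f (second q)) j)))))
    where
    bottom : map low (replicate i ab ++ replicate j mix ++ ts) ≡ replicate i ab ++ replicate j mix ++ ts
    bottom = trans (map-segment low i ab _) (cong (replicate i ab ++_)
      (trans (map-segment low j mix ts) (cong (replicate j mix ++_) e₁)))
    first : ∀ p → map high (bot ∷ replicate p ab) ++ mix ∷ ts ≡ word₁ 0 (suc p) ts
    first p = cong (bot ∷_) (trans (cong (_++ mix ∷ ts) (List.map-replicate high p ab)) (replicate-snoc p mix ts))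
    second : ∀ q → map high ((bot ∷ replicate i ab) ++ replicate q mix) ++ mix ∷ [] ≡ word₁ 0 (suc (q ℕ.+ i)) []
    second q = cong (bot ∷_) (trans (cong (_++ mix ∷ []) (trans (map-segment high i ab (replicate q mix))
        (cong (replicate i mix ++_) (List.map-replicate high q mix))))
      (trans (List.++-assoc (replicate i mix) (replicate q mix) (mix ∷ []))
        (trans (replicate-+ q i mix (mix ∷ [])) (replicate-snoc (q ℕ.+ i) mix []))))

  -- A lower entry turns `ba` into `mix`, so an insertion at the bottom merges the two runs and
  -- leads back to `word₁`, whereas higher entries preserve both runs.
  total-word₂ : ∀ j k ts → total f [] (word₂ j k ts) ≡
    f (word₁ 1 (j ℕ.+ k) (map low ts)) + (Σℤ j (λ q → f (word₁ 0 (suc q) [])) + (Σℤ k (λ r → f (word₂ j (suc r) (mix ∷ [])))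
      + total f (bot ∷ replicate j mix ++ replicate k ba) ts))
  total-word₂ j k ts = cong₂ _+_ (cong (λ x → f (bot ∷ ab ∷ x)) bottom)
    (trans (total-replicate f mix (replicate k ba ++ ts) (mix ∷ []) (λ m → refl) j (bot ∷ []))
      (cong₂ _+_ (Σℤ-cong (λ q → cong f (first q)) j)
        (trans (total-replicate f ba ts (ba ∷ mix ∷ []) (λ m → refl) k (bot ∷ replicate j mix))
          (cong (λ x → x + total f (bot ∷ replicate j mix ++ replicate k ba) ts) (Σℤ-cong (λ r → cong f (second r)) k)))))
    where
    bottom : map low (replicate j mix ++ replicate k ba ++ ts) ≡ replicate (j ℕ.+ k) mix ++ map low ts
    bottom = trans (map-segment low j mix _) (trans (cong (replicate j mix ++_) (map-segment low k ba ts))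
      (trans (replicate-+ k j mix (map low ts)) (cong (λ m → replicate m mix ++ map low ts) (ℕ.+-comm k j))))
    first : ∀ q → map high (bot ∷ replicate q mix) ++ mix ∷ [] ≡ word₁ 0 (suc q) []
    first q = cong (bot ∷_) (trans (cong (_++ mix ∷ []) (List.map-replicate high q mix)) (replicate-snoc q mix []))
    second : ∀ r → map high ((bot ∷ replicate j mix) ++ replicate r ba) ++ ba ∷ mix ∷ [] ≡ word₂ j (suc r) (mix ∷ [])
    second r = cong (bot ∷_) (trans (cong (_++ ba ∷ mix ∷ []) (trans (map-segment high j mix (replicate r ba))
        (cong (replicate j mix ++_) (List.map-replicate high r ba))))
      (trans (List.++-assoc (replicate j mix) (replicate r ba) (ba ∷ mix ∷ []))
        (cong (replicate j mix ++_) (replicate-snoc r ba (mix ∷ [])))))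

high-word₁ : ∀ i j ts → map high (bot ∷ replicate i ab ++ replicate j mix) ++ ts ≡ bot ∷ replicate (j ℕ.+ i) mix ++ ts
high-word₁ i j ts = cong (bot ∷_) (trans (cong (_++ ts) (trans (map-segment high i ab (replicate j mix))
    (cong (replicate i mix ++_) (List.map-replicate high j mix))))
  (trans (List.++-assoc (replicate i mix) (replicate j mix) ts) (replicate-+ j i mix ts)))

high-word₂ : ∀ j k ts → map high (bot ∷ replicate j mix ++ replicate k ba) ++ ts ≡ word₂ j k ts
high-word₂ j k ts = cong (bot ∷_) (trans (cong (_++ ts) (trans (map-segment high j mix (replicate k ba))
    (cong (replicate j mix ++_) (List.map-replicate high k ba))))
  (List.++-assoc (replicate j mix) (replicate k ba) ts))

Σ-val : ∀ m (w : ℕ → List SiteType) (v : ℕ → Series) n → (∀ i → cnt (w i) n ≡ v i n) →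
  Σℤ m (λ i → cnt (w i) n) ≡ Σₛ m v n
Σ-val m w v n p = trans (Σℤ-cong p m) (sym (Σₛ-coeff m v n))

-- The families refer to one another with larger indices, but always at the preceding coefficient;
-- hence one simultaneous induction on `n` for all indices. At `n = 0` the right-hand side 1 + z
-- (...) computes to 1.
cnt-X : ∀ n i j → cnt (word₁ i j []) n ≡ valX i j n
cnt-U : ∀ n i j → cnt (word₁ i j (top ∷ [])) n ≡ valU i j n
cnt-Y : ∀ n j k → cnt (word₂ j k (top ∷ [])) n ≡ valY j k n
cnt-Z : ∀ n j k → cnt (word₂ j k (mix ∷ [])) n ≡ valZ j k n

cnt-X zero    i j = sym (X-eq i j 0)
cnt-X (suc n) i j = trans
  (trans (total-word₁ (λ us → cnt us n) i j [] refl refl)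
    (cong₂ _+_ (cnt-X n (suc i) j)
      (cong₂ _+_ (Σ-val i _ _ n (λ p → cnt-X n 0 (suc p)))
        (trans (ℤ.+-identityʳ _) (Σ-val j _ _ n (λ q → cnt-X n 0 (suc (q ℕ.+ i))))))))
  (sym (trans (X-eq i j (suc n)) (trans (ℤ.+-identityˡ _) (z-⊛-suc _ n))))

cnt-U zero    i j = sym (U-eq i j 0)
cnt-U (suc n) i j = trans
  (trans (total-word₁ (λ us → cnt us n) i j (top ∷ []) refl refl)
    (cong₂ _+_ (cnt-U n (suc i) j)
      (cong₂ _+_ (Σ-val i _ _ n (λ p → cnt-U n 0 (suc p)))
        (cong₂ _+_ (Σ-val j _ _ n (λ q → cnt-X n 0 (suc (q ℕ.+ i))))
          (trans (ℤ.+-identityʳ _)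
            (trans (cong (λ us → cnt us n) (high-word₁ i j (ba ∷ top ∷ []))) (cnt-Y n (j ℕ.+ i) 1)))))))
  (sym (trans (U-eq i j (suc n)) (trans (ℤ.+-identityˡ _) (z-⊛-suc _ n))))

cnt-Y zero    j k = sym (Y-eq j k 0)
cnt-Y (suc n) j k = trans
  (trans (total-word₂ (λ us → cnt us n) j k (top ∷ []))
    (cong₂ _+_ (cnt-U n 1 (j ℕ.+ k))
      (cong₂ _+_ (Σ-val j _ _ n (λ q → cnt-X n 0 (suc q)))
        (cong₂ _+_ (Σ-val k _ _ n (λ r → cnt-Z n j (suc r)))
          (trans (ℤ.+-identityʳ _)
            (trans (cong (λ us → cnt us n) (trans (high-word₂ j k (ba ∷ top ∷ []))
                (cong (λ us → bot ∷ replicate j mix ++ us) (replicate-snoc k ba (top ∷ [])))))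
              (cnt-Y n j (suc k))))))))
  (sym (trans (Y-eq j k (suc n)) (trans (ℤ.+-identityˡ _) (z-⊛-suc _ n))))

cnt-Z zero    j k = sym (Z-eq j k 0)
cnt-Z (suc n) j k = trans
  (trans (total-word₂ (λ us → cnt us n) j k (mix ∷ []))
    -- The final `mix` of the word joins the merged run, so this child lies in family X.
    (cong₂ _+_ (trans (cong (λ us → cnt (bot ∷ ab ∷ us) n) (replicate-snoc (j ℕ.+ k) mix []))
                      (cnt-X n 1 (suc (j ℕ.+ k))))
      (cong₂ _+_ (Σ-val j _ _ n (λ q → cnt-X n 0 (suc q)))
        (cong₂ _+_ (Σ-val k _ _ n (λ r → cnt-Z n j (suc r)))
          (trans (ℤ.+-identityʳ _)
            (trans (cong (λ us → cnt us n) (high-word₂ j k (mix ∷ []))) (cnt-Z n j k)))))))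
  (sym (trans (Z-eq j k (suc n)) (trans (ℤ.+-identityˡ _) (z-⊛-suc _ n))))

-- The only child of the empty permutation has the sites `bot` and `top`, which is the word U 0 0.
cnt-root : cnt (emp ∷ []) ≋ 1ₛ ⊕ z ⊛ valU 0 0
cnt-root = fixpoint-z (cnt (emp ∷ [])) refl (valU 0 0) λ n → trans (ℤ.+-identityʳ _) (cnt-U n 0 0)

-- Forbidden patterns and active sites

<ᵇ⇒ : ∀ {m n} → (m <ᵇ n) ≡ true → m < n
<ᵇ⇒ {m} {n} e = ℕ.<ᵇ⇒< m n (subst T (sym e) _)

≮ᵇ⇒ : ∀ {m n} → (m <ᵇ n) ≡ false → n ≤ m
≮ᵇ⇒ {m} {n} e = ℕ.≮⇒≥ λ m<n → subst T e (ℕ.<⇒<ᵇ m<n)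

⇒<ᵇ : ∀ {m n} → m < n → (m <ᵇ n) ≡ true
⇒<ᵇ {m} {n} m<n with m <ᵇ n in e
... | true  = refl
... | false = ⊥-elim (ℕ.<⇒≱ m<n (≮ᵇ⇒ e))

⇒≮ᵇ : ∀ {m n} → n ≤ m → (m <ᵇ n) ≡ false
⇒≮ᵇ {m} {n} n≤m with m <ᵇ n in e
... | false = refl
... | true  = ⊥-elim (ℕ.<⇒≱ (<ᵇ⇒ e) n≤m)

-- Permutations are read from right to left from here on: the last entry is the head of the list.
siteType : List ℕ → ℕ → SiteType
siteType []      w = emp
siteType (x ∷ p) w = if x <ᵇ w then low (siteType p w) else high (siteType p w)

noneBetween : ℕ → ℕ → List ℕ → Bool
noneBetween v w = all (λ x → (x <ᵇ v) ∨ not (x <ᵇ w))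

admits : SiteType → List ℕ → ℕ → ℕ → Bool
admits emp p v w = true
admits bot p v w = true
admits top p v w = true
admits ab  p v w = isTop (siteType p w)
admits ba  p v w = noneBetween v w p
admits mix p v w = false

-- A pattern that an entry at `w` would complete has its second last entry at some `v < w`, so each
-- such `v` is tested against the entries `p` that precede it.
active : ℕ → List ℕ → Bool
active w []      = true
active w (v ∷ p) = (if v <ᵇ w then admits (siteType p v) p v w else true) ∧ active w p

avoids : List ℕ → Bool
avoids []      = true
avoids (v ∷ p) = active v p ∧ avoids p

-- What precedes (in reversed order) the last two entries v < w of an occurrence of a forbidden pattern.
-- Weak inequalities let w be a site, that is, a threshold just below the entries ≥ w.
data Shape (v w : ℕ) : List ℕ → Set where
  s4123  : ∀ {a c} → a < v → w ≤ c → Shape v w (a ∷ c ∷ [])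
  s1324  : ∀ {a c} → a < v → v ≤ c → c < w → Shape v w (c ∷ a ∷ [])
  s31524 : ∀ {a c d} → a < v → v ≤ c → c < w → w ≤ d → Shape v w (d ∷ a ∷ c ∷ [])

-- Subsequences are taken in the reversed word: `a ∷ c` means that `a` comes after `c`. For `ab` and
-- `ba` the opposite order must be excluded in order to know which sites survive; for `mix` a
-- witness of one of the two alternations suffices.
data Spec (p : List ℕ) (v : ℕ) : SiteType → Set where
  specEmp : p ≡ [] → Spec p v emp
  specBot : ∀ {c} → c ∈ p → (∀ {x} → x ∈ p → v ≤ x) → Spec p v bot
  specTop : ∀ {a} → a ∈ p → (∀ {x} → x ∈ p → x < v) → Spec p v top
  specAb  : ∀ {a c} → (a ∷ c ∷ []) ⊆ p → a < v → v ≤ c →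
          (∀ {a c} → (c ∷ a ∷ []) ⊆ p → v ≤ c → a < v → ⊥) → Spec p v ab
  specBa  : ∀ {a c} → (c ∷ a ∷ []) ⊆ p → a < v → v ≤ c →
          (∀ {a c} → (a ∷ c ∷ []) ⊆ p → v ≤ c → a < v → ⊥) → Spec p v ba
  specMix₁ : ∀ {a c c′} → (c′ ∷ a ∷ c ∷ []) ⊆ p → a < v → v ≤ c → v ≤ c′ → Spec p v mix
  specMix₂ : ∀ {a c a′} → (a ∷ c ∷ a′ ∷ []) ⊆ p → a < v → v ≤ c → a′ < v → Spec p v mix

first-∈ : ∀ {x : ℕ} {xs p} → (x ∷ xs) ⊆ p → x ∈ p
first-∈ s = Sub.lookup s (here refl)

second-∈ : ∀ {x y : ℕ} {xs p} → (x ∷ y ∷ xs) ⊆ p → y ∈ p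
second-∈ s = Sub.lookup s (there (here refl))

spec-low : ∀ {x p v t} → x < v → Spec p v t → Spec (x ∷ p) v (low t)
spec-low x<v (specEmp refl)        = specTop (here refl) λ { (here refl) → x<v }
spec-low x<v (specBot c∈p ≥v)      = specAb (refl ∷ Sub.from∈ c∈p) x<v (≥v c∈p) λ
  { (y ∷ʳ s) v≤c a<v → ℕ.<⇒≱ a<v (≥v (second-∈ s)) ; (refl ∷ s) v≤c a<v → ℕ.<⇒≱ x<v v≤c }
spec-low x<v (specTop a∈p <v)      = specTop (there a∈p) λ { (here refl) → x<v ; (there i) → <v i }
spec-low x<v (specAb s a<v v≤c n)  = specAb (_ ∷ʳ s) a<v v≤c λ
  { (y ∷ʳ s) v≤c a<v → n s v≤c a<v ; (refl ∷ s) v≤c a<v → ℕ.<⇒≱ x<v v≤c }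
spec-low x<v (specBa s a<v v≤c n)  = specMix₂ (refl ∷ s) x<v v≤c a<v
spec-low x<v (specMix₁ s p q r)    = specMix₁ (_ ∷ʳ s) p q r
spec-low x<v (specMix₂ s p q r)    = specMix₂ (_ ∷ʳ s) p q r

spec-high : ∀ {x p v t} → v ≤ x → Spec p v t → Spec (x ∷ p) v (high t)
spec-high v≤x (specEmp refl)       = specBot (here refl) λ { (here refl) → v≤x }
spec-high v≤x (specBot c∈p ≥v)     = specBot (there c∈p) λ { (here refl) → v≤x ; (there i) → ≥v i }
spec-high v≤x (specTop a∈p <v)     = specBa (refl ∷ Sub.from∈ a∈p) (<v a∈p) v≤x λ
  { (y ∷ʳ s) v≤c a<v → ℕ.<⇒≱ (<v (second-∈ s)) v≤c ; (refl ∷ s) v≤c a<v → ℕ.<⇒≱ a<v v≤x }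
spec-high v≤x (specAb s a<v v≤c n) = specMix₁ (refl ∷ s) a<v v≤c v≤x
spec-high v≤x (specBa s a<v v≤c n) = specBa (_ ∷ʳ s) a<v v≤c λ
  { (y ∷ʳ s) v≤c a<v → n s v≤c a<v ; (refl ∷ s) v≤c a<v → ℕ.<⇒≱ a<v v≤x }
spec-high v≤x (specMix₁ s p q r)   = specMix₁ (_ ∷ʳ s) p q r
spec-high v≤x (specMix₂ s p q r)   = specMix₂ (_ ∷ʳ s) p q r

spec : ∀ p v → Spec p v (siteType p v)
spec []      v = specEmp refl
spec (x ∷ p) v with x <ᵇ v in e
... | true  = spec-low (<ᵇ⇒ e) (spec p v)
... | false = spec-high (≮ᵇ⇒ e) (spec p v)

isTop-true : ∀ {p w t} → Spec p w t → isTop t ≡ true → ∀ {x} → x ∈ p → x < w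
isTop-true (specEmp refl)   e ()
isTop-true (specTop a∈p <w) e i = <w i

isTop-false : ∀ {p w t} → Spec p w t → isTop t ≡ false → ∃ λ x → x ∈ p × w ≤ x
isTop-false (specBot c∈p ≥w)   e = _ , c∈p , ≥w c∈p
isTop-false (specAb s _ q _)   e = _ , second-∈ s , q
isTop-false (specBa s _ q _)   e = _ , first-∈ s , q
isTop-false (specMix₁ s _ _ q) e = _ , first-∈ s , q
isTop-false (specMix₂ s _ q _) e = _ , second-∈ s , q

noneBetween-true : ∀ v w p → noneBetween v w p ≡ true → ∀ {x} → x ∈ p → v ≤ x → x < w → ⊥
noneBetween-true v w (y ∷ p) e i v≤x x<w with y <ᵇ v in e₁ | y <ᵇ w in e₂ | i
... | true  | _     | here refl = ℕ.<⇒≱ (<ᵇ⇒ e₁) v≤x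
... | false | false | here refl = ℕ.<⇒≱ x<w (≮ᵇ⇒ e₂)
... | true  | _     | there j   = noneBetween-true v w p e j v≤x x<w
... | false | false | there j   = noneBetween-true v w p e j v≤x x<w

noneBetween-false : ∀ v w p → noneBetween v w p ≡ false → ∃ λ x → x ∈ p × v ≤ x × x < w
noneBetween-false v w (y ∷ p) e with y <ᵇ v in e₁ | y <ᵇ w in e₂
... | false | true  = y , here refl , ≮ᵇ⇒ e₁ , <ᵇ⇒ e₂
... | true  | _     = let x , i , q = noneBetween-false v w p e in x , there i , q
... | false | false = let x , i , q = noneBetween-false v w p e in x , there i , q

pair-⊆ : ∀ {x y : ℕ} {p} → x ∈ p → y ∈ p → x ≢ y → (x ∷ y ∷ []) ⊆ p ⊎ (y ∷ x ∷ []) ⊆ p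
pair-⊆ (here refl) (here refl) x≢y = ⊥-elim (x≢y refl)
pair-⊆ (here refl) (there j)   x≢y = inj₁ (refl ∷ Sub.from∈ j)
pair-⊆ (there i)   (here refl) x≢y = inj₂ (refl ∷ Sub.from∈ i)
pair-⊆ (there i)   (there j)   x≢y with pair-⊆ i j x≢y
... | inj₁ s = inj₁ (_ ∷ʳ s)
... | inj₂ s = inj₂ (_ ∷ʳ s)

admits-sound : ∀ {p v w s t} → Spec p v t → v < w → admits t p v w ≡ true → s ⊆ p → ¬ Shape v w s
admits-sound (specEmp refl)   v<w e s (s4123 a<v w≤c) with first-∈ s
... | ()
admits-sound (specEmp refl)   v<w e s (s1324 a<v v≤c c<w) with first-∈ s
... | ()
admits-sound (specEmp refl)   v<w e s (s31524 a<v v≤c c<w w≤d) with first-∈ s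
... | ()
admits-sound (specBot _ ≥v)   v<w e s (s4123 a<v w≤c)           = ℕ.<⇒≱ a<v (≥v (first-∈ s))
admits-sound (specBot _ ≥v)   v<w e s (s1324 a<v v≤c c<w)       = ℕ.<⇒≱ a<v (≥v (second-∈ s))
admits-sound (specBot _ ≥v)   v<w e s (s31524 a<v v≤c c<w w≤d)  = ℕ.<⇒≱ a<v (≥v (second-∈ s))
admits-sound (specTop _ <v)   v<w e s (s4123 a<v w≤c)           = ℕ.<⇒≱ (ℕ.<-trans (<v (second-∈ s)) v<w) w≤c
admits-sound (specTop _ <v)   v<w e s (s1324 a<v v≤c c<w)       = ℕ.<⇒≱ (<v (first-∈ s)) v≤c
admits-sound (specTop _ <v)   v<w e s (s31524 a<v v≤c c<w w≤d)  = ℕ.<⇒≱ (ℕ.<-trans (<v (first-∈ s)) v<w) w≤d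
admits-sound {p} {w = w} (specAb _ _ _ n) v<w e s (s4123 a<v w≤c)          = ℕ.<⇒≱ (isTop-true (spec p w) e (second-∈ s)) w≤c
admits-sound {p} {w = w} (specAb _ _ _ n) v<w e s (s1324 a<v v≤c c<w)      = n s v≤c a<v
admits-sound {p} {w = w} (specAb _ _ _ n) v<w e s (s31524 a<v v≤c c<w w≤d) = ℕ.<⇒≱ (isTop-true (spec p w) e (first-∈ s)) w≤d
admits-sound (specBa _ _ _ n) v<w e s (s4123 a<v w≤c)           = n s (ℕ.≤-trans (ℕ.<⇒≤ v<w) w≤c) a<v
admits-sound {p} {v} {w} (specBa _ _ _ n) v<w e s (s1324 a<v v≤c c<w) = noneBetween-true v w p e (first-∈ s) v≤c c<w
admits-sound (specBa _ _ _ n) v<w e s (s31524 a<v v≤c c<w w≤d)  = n (⊆-trans (_ ∷ʳ Sub.⊆-refl) s) v≤c a<v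

admits-complete : ∀ {p v w t} → Spec p v t → v < w → admits t p v w ≡ false → ∃ λ s → s ⊆ p × Shape v w s
admits-complete {p} {v} {w} (specAb s a<v _ n) v<w e with isTop-false (spec p w) e
... | x , x∈p , w≤x with pair-⊆ (first-∈ s) x∈p (ℕ.<⇒≢ (ℕ.<-≤-trans (ℕ.<-trans a<v v<w) w≤x))
... | inj₁ s′ = _ , s′ , s4123 a<v w≤x
... | inj₂ s′ = ⊥-elim (n s′ (ℕ.≤-trans (ℕ.<⇒≤ v<w) w≤x) a<v)
admits-complete {p} {v} {w} (specBa s a<v _ n) v<w e with noneBetween-false v w p e
... | x , x∈p , v≤x , x<w with pair-⊆ (second-∈ s) x∈p (ℕ.<⇒≢ (ℕ.<-≤-trans a<v v≤x))
... | inj₁ s′ = ⊥-elim (n s′ v≤x a<v)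
... | inj₂ s′ = _ , s′ , s1324 a<v v≤x x<w
admits-complete {p} {v} {w} (specMix₁ {c = c} {c′} s a<v v≤c v≤c′) v<w e with w ℕ.≤? c | w ℕ.≤? c′
... | yes w≤c | _        = _ , ⊆-trans (_ ∷ʳ Sub.⊆-refl) s , s4123 a<v w≤c
... | no  w≰c | yes w≤c′ = _ , s , s31524 a<v v≤c (ℕ.≰⇒> w≰c) w≤c′
... | no  w≰c | no w≰c′  = _ , ⊆-trans (refl ∷ refl ∷ _ ∷ʳ []) s , s1324 a<v v≤c′ (ℕ.≰⇒> w≰c′)
admits-complete {p} {v} {w} (specMix₂ {c = c} s a<v v≤c a′<v) v<w e with w ℕ.≤? c
... | yes w≤c = _ , ⊆-trans (refl ∷ refl ∷ _ ∷ʳ []) s , s4123 a<v w≤c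
... | no  w≰c = _ , ⊆-trans (_ ∷ʳ Sub.⊆-refl) s , s1324 a′<v v≤c (ℕ.≰⇒> w≰c)

Hit : ℕ → List ℕ → Set
Hit w r = ∃₂ λ v s → (v ∷ s) ⊆ r × v < w × Shape v w s

active-sound : ∀ w r → active w r ≡ true → ¬ Hit w r
active-sound w (v ∷ p) e (v′ , s , sub , v′<w , sh) with v <ᵇ w in e₁ | admits (siteType p v) p v w in e₂ | sub
... | true  | true | y ∷ʳ sub′   = active-sound w p e (v′ , s , sub′ , v′<w , sh)
... | true  | true | refl ∷ sub′ = admits-sound (spec p v) v′<w e₂ sub′ sh
... | false | _    | y ∷ʳ sub′   = active-sound w p e (v′ , s , sub′ , v′<w , sh)
... | false | _    | refl ∷ sub′ = ℕ.<⇒≱ v′<w (≮ᵇ⇒ e₁)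

active-complete : ∀ w r → active w r ≡ false → Hit w r
active-complete w (v ∷ p) e with v <ᵇ w in e₁ | admits (siteType p v) p v w in e₂
... | true | false = let s , sub , sh = admits-complete (spec p v) (<ᵇ⇒ e₁) e₂ in v , s , refl ∷ sub , <ᵇ⇒ e₁ , sh
... | true | true  = let v′ , s , sub , q = active-complete w p e in v′ , s , _ ∷ʳ sub , q
... | false | _    = let v′ , s , sub , q = active-complete w p e in v′ , s , _ ∷ʳ sub , q

Occ : List ℕ → Set
Occ r = ∃ λ w → ∃₂ λ v s → (w ∷ v ∷ s) ⊆ r × v < w × Shape v w s

avoids-sound : ∀ r → avoids r ≡ true → ¬ Occ r
avoids-sound (w ∷ p) e (w′ , v , s , sub , q) with active w p in e₁ | sub
... | true | y ∷ʳ sub′   = avoids-sound p e (w′ , v , s , sub′ , q)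
... | true | refl ∷ sub′ = active-sound w p e₁ (v , s , sub′ , q)

avoids-complete : ∀ r → avoids r ≡ false → Occ r
avoids-complete (w ∷ p) e with active w p in e₁
... | false = let v , s , sub , q = active-complete w p e₁ in w , v , s , refl ∷ sub , q
... | true  = let w′ , v , s , sub , q = avoids-complete p e in w′ , v , s , _ ∷ʳ sub , q

-- Agreement with pattern containment in the sense of Defs

record SameOrder (x y a b : ℕ) : Set where
  constructor _&_
  field
    below : (x <ᵇ a) ≡ (y <ᵇ b)
    above : (a <ᵇ x) ≡ (b <ᵇ y)

data Iso : List ℕ → List ℕ → Set where
  []  : Iso [] []
  _∷_ : ∀ {x y as bs} → Pointwise (SameOrder x y) as bs → Iso as bs → Iso (x ∷ as) (y ∷ bs)

Iso-head : ∀ x y {as bs} → Iso as bs → headAgree x y as bs ≡ true → Pointwise (SameOrder x y) as bs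
Iso-head x y [] e = []
Iso-head x y (_∷_ {a} {b} _ iso) e with x <ᵇ a in p | y <ᵇ b in q | a <ᵇ x in p′ | b <ᵇ y in q′
... | true  | true  | true  | true  = (trans p (sym q) & trans p′ (sym q′)) ∷ Iso-head x y iso e
... | true  | true  | false | false = (trans p (sym q) & trans p′ (sym q′)) ∷ Iso-head x y iso e
... | false | false | true  | true  = (trans p (sym q) & trans p′ (sym q′)) ∷ Iso-head x y iso e
... | false | false | false | false = (trans p (sym q) & trans p′ (sym q′)) ∷ Iso-head x y iso e

orderIso⇒Iso : ∀ as bs → orderIso as bs ≡ true → Iso as bs
orderIso⇒Iso []       []       e = []
orderIso⇒Iso (x ∷ as) (y ∷ bs) e with headAgree x y as bs in p
... | true = let iso = orderIso⇒Iso as bs e in Iso-head x y iso p ∷ iso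

headAgree-true : ∀ x y {as bs} → Pointwise (SameOrder x y) as bs → headAgree x y as bs ≡ true
headAgree-true x y [] = refl
headAgree-true x y (_∷_ {a} {b} (p & q) ps) with x <ᵇ a | y <ᵇ b | a <ᵇ x | b <ᵇ y
... | true  | true  | true  | true  = headAgree-true x y ps
... | true  | true  | false | false = headAgree-true x y ps
... | false | false | true  | true  = headAgree-true x y ps
... | false | false | false | false = headAgree-true x y ps

Iso⇒orderIso : ∀ {as bs} → Iso as bs → orderIso as bs ≡ true
Iso⇒orderIso [] = refl
Iso⇒orderIso (_∷_ {x} {y} ps iso) rewrite headAgree-true x y ps = Iso⇒orderIso iso

∈-subseqs⁺ : ∀ {s xs} → s ⊆ xs → s ∈ subseqs xs
∈-subseqs⁺ []         = here refl
∈-subseqs⁺ (_∷ʳ_ {ys = xs} y s) = ∈.∈-++⁺ʳ (map (y ∷_) (subseqs xs)) (∈-subseqs⁺ s)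
∈-subseqs⁺ (refl ∷ s) = ∈.∈-++⁺ˡ (∈.∈-map⁺ _ (∈-subseqs⁺ s))

∈-subseqs⁻ : ∀ {s} xs → s ∈ subseqs xs → s ⊆ xs
∈-subseqs⁻ []       (here refl) = []
∈-subseqs⁻ (x ∷ xs) i with ∈.∈-++⁻ (map (x ∷_) (subseqs xs)) i
... | inj₂ j = x ∷ʳ ∈-subseqs⁻ xs j
... | inj₁ j with ∈.∈-map⁻ (x ∷_) j
... | _ , k , refl = refl ∷ ∈-subseqs⁻ xs k

T⇒≡ : ∀ {b} → T b → b ≡ true
T⇒≡ {true} _ = refl

≡⇒T : ∀ {b} → b ≡ true → T b
≡⇒T refl = _

contains⁺ : ∀ {s σ π} → s ⊆ σ → Iso s π → T (contains σ π)
contains⁺ {π = π} sub iso = Any.any⁺ (λ s → orderIso s π) (lose (∈-subseqs⁺ sub) (≡⇒T (Iso⇒orderIso iso)))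

contains⁻ : ∀ σ π → T (contains σ π) → ∃ λ s → s ⊆ σ × Iso s π
contains⁻ σ π t with find (Any.any⁻ (λ s → orderIso s π) (subseqs σ) t)
... | s , i , q = s , ∈-subseqs⁻ σ i , orderIso⇒Iso s π (T⇒≡ q)

π₁ π₂ π₃ : List ℕ
π₁ = 4 ∷ 1 ∷ 2 ∷ 3 ∷ []
π₂ = 1 ∷ 3 ∷ 2 ∷ 4 ∷ []
π₃ = 3 ∷ 1 ∷ 5 ∷ 2 ∷ 4 ∷ []

ContainsBasis : List ℕ → Set
ContainsBasis σ = T (contains σ π₁) ⊎ T (contains σ π₂) ⊎ T (contains σ π₃)

ascends : ∀ {x y a b} → x < a → y < b → SameOrder x y a b
ascends p q = trans (⇒<ᵇ p) (sym (⇒<ᵇ q)) & trans (⇒≮ᵇ (ℕ.<⇒≤ p)) (sym (⇒≮ᵇ (ℕ.<⇒≤ q)))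

descends : ∀ {x y a b} → a < x → b < y → SameOrder x y a b
descends p q = trans (⇒≮ᵇ (ℕ.<⇒≤ p)) (sym (⇒≮ᵇ (ℕ.<⇒≤ q))) & trans (⇒<ᵇ p) (sym (⇒<ᵇ q))

reverse-⊆ : ∀ {s r : List ℕ} → s ⊆ reverse r → reverse s ⊆ r
reverse-⊆ {s} {r} sub = subst (reverse s ⊆_) (List.reverse-involutive r) (reverse⁺ sub)

contains⇒Occ : ∀ r → ContainsBasis (reverse r) → Occ r
contains⇒Occ r (inj₁ t) with contains⁻ (reverse r) π₁ t
... | c ∷ a ∷ v ∷ w ∷ [] , sub ,
      (_ ∷ _ ∷ (_ & wc) ∷ []) ∷ ((av & _) ∷ _ ∷ []) ∷ ((vw & _) ∷ []) ∷ [] ∷ [] =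
  w , v , _ , reverse-⊆ sub , <ᵇ⇒ vw , s4123 (<ᵇ⇒ av) (ℕ.<⇒≤ (<ᵇ⇒ wc))
contains⇒Occ r (inj₂ (inj₁ t)) with contains⁻ (reverse r) π₂ t
... | a ∷ c ∷ v ∷ w ∷ [] , sub ,
      (_ ∷ (av & _) ∷ _ ∷ []) ∷ ((_ & vc) ∷ (cw & _) ∷ []) ∷ ((vw & _) ∷ []) ∷ [] ∷ [] =
  w , v , _ , reverse-⊆ sub , <ᵇ⇒ vw , s1324 (<ᵇ⇒ av) (ℕ.<⇒≤ (<ᵇ⇒ vc)) (<ᵇ⇒ cw)
contains⇒Occ r (inj₂ (inj₂ t)) with contains⁻ (reverse r) π₃ t
... | c ∷ a ∷ d ∷ v ∷ w ∷ [] , sub ,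
      (_ ∷ _ ∷ (_ & vc) ∷ (cw & _) ∷ []) ∷ (_ ∷ (av & _) ∷ _ ∷ []) ∷ (_ ∷ (_ & wd) ∷ []) ∷ ((vw & _) ∷ []) ∷ [] ∷ [] =
  w , v , _ , reverse-⊆ sub , <ᵇ⇒ vw , s31524 (<ᵇ⇒ av) (ℕ.<⇒≤ (<ᵇ⇒ vc)) (<ᵇ⇒ cw) (ℕ.<⇒≤ (<ᵇ⇒ wd))

Unique-⊆ : ∀ {s r : List ℕ} → s ⊆ r → Unique r → Unique s
Unique-⊆ []         u       = u
Unique-⊆ (y ∷ʳ s)   (_ ∷ u) = Unique-⊆ s u
Unique-⊆ (refl ∷ s) (p ∷ u) = All-resp-⊆ s p ∷ Unique-⊆ s u

-- The weak inequalities of `Shape` become strict because the entries of `r` are distinct; the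
-- remaining comparisons follow by transitivity.
Occ⇒contains : ∀ r → Unique r → Occ r → ContainsBasis (reverse r)
Occ⇒contains r u (w , v , _ , sub , v<w , s4123 {a} {c} a<v w≤c) with Unique-⊆ sub u
... | (_ ∷ _ ∷ w≢c ∷ []) ∷ _ = inj₁ (contains⁺ {c ∷ a ∷ v ∷ w ∷ []} {π = π₁} (reverse⁺ sub)
    -- The comparisons on the pattern side are between numerals and hold by computation.
    ((descends (ℕ.<-trans a<v v<c) (ℕ.<ᵇ⇒< _ _ _) ∷ descends v<c (ℕ.<ᵇ⇒< _ _ _) ∷ descends w<c (ℕ.<ᵇ⇒< _ _ _) ∷ [])
    ∷ (ascends a<v (ℕ.<ᵇ⇒< _ _ _) ∷ ascends (ℕ.<-trans a<v v<w) (ℕ.<ᵇ⇒< _ _ _) ∷ []) ∷ (ascends v<w (ℕ.<ᵇ⇒< _ _ _) ∷ []) ∷ [] ∷ []))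
  where
  w<c = ℕ.≤∧≢⇒< w≤c w≢c
  v<c = ℕ.<-trans v<w w<c
Occ⇒contains r u (w , v , _ , sub , v<w , s1324 {a} {c} a<v v≤c c<w) with Unique-⊆ sub u
... | _ ∷ (v≢c ∷ _) ∷ _ = inj₂ (inj₁ (contains⁺ {a ∷ c ∷ v ∷ w ∷ []} {π = π₂} (reverse⁺ sub)
    ((ascends (ℕ.<-trans a<v v<c) (ℕ.<ᵇ⇒< _ _ _) ∷ ascends a<v (ℕ.<ᵇ⇒< _ _ _) ∷ ascends (ℕ.<-trans a<v v<w) (ℕ.<ᵇ⇒< _ _ _) ∷ [])
    ∷ (descends v<c (ℕ.<ᵇ⇒< _ _ _) ∷ ascends c<w (ℕ.<ᵇ⇒< _ _ _) ∷ []) ∷ (ascends v<w (ℕ.<ᵇ⇒< _ _ _) ∷ []) ∷ [] ∷ [])))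
  where
  v<c = ℕ.≤∧≢⇒< v≤c v≢c
Occ⇒contains r u (w , v , _ , sub , v<w , s31524 {a} {c} {d} a<v v≤c c<w w≤d) with Unique-⊆ sub u
... | (_ ∷ w≢d ∷ _) ∷ (_ ∷ _ ∷ v≢c ∷ []) ∷ _ =
  inj₂ (inj₂ (contains⁺ {c ∷ a ∷ d ∷ v ∷ w ∷ []} {π = π₃} (reverse⁺ sub)
    ((descends (ℕ.<-trans a<v v<c) (ℕ.<ᵇ⇒< _ _ _) ∷ ascends (ℕ.<-trans c<w w<d) (ℕ.<ᵇ⇒< _ _ _) ∷ descends v<c (ℕ.<ᵇ⇒< _ _ _) ∷ ascends c<w (ℕ.<ᵇ⇒< _ _ _) ∷ [])
    ∷ (ascends (ℕ.<-trans a<v (ℕ.<-trans v<w w<d)) (ℕ.<ᵇ⇒< _ _ _) ∷ ascends a<v (ℕ.<ᵇ⇒< _ _ _) ∷ ascends (ℕ.<-trans a<v v<w) (ℕ.<ᵇ⇒< _ _ _) ∷ [])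
    ∷ (descends (ℕ.<-trans v<w w<d) (ℕ.<ᵇ⇒< _ _ _) ∷ descends w<d (ℕ.<ᵇ⇒< _ _ _) ∷ [])
    ∷ (ascends v<w (ℕ.<ᵇ⇒< _ _ _) ∷ []) ∷ [] ∷ [])))
  where
  v<c = ℕ.≤∧≢⇒< v≤c v≢c
  w<d = ℕ.≤∧≢⇒< w≤d w≢d

avoidsAll⇒avoids : ∀ r → Unique r → T (avoidsAll basis (reverse r)) → avoids r ≡ true
avoidsAll⇒avoids r u t with avoids r in e
... | true  = refl
... | false with contains (reverse r) π₁ | contains (reverse r) π₂ | contains (reverse r) π₃
               | Occ⇒contains r u (avoids-complete r e)
... | false | false | false | inj₂ (inj₂ ())

avoids⇒avoidsAll : ∀ r → avoids r ≡ true → T (avoidsAll basis (reverse r))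
avoids⇒avoidsAll r e with contains (reverse r) π₁ | contains (reverse r) π₂ | contains (reverse r) π₃
                        | avoids-sound r e ∘ contains⇒Occ r
... | false | false | false | _ = _
... | true  | _     | _     | n = n (inj₁ _)
... | false | true  | _     | n = n (inj₂ (inj₁ _))
... | false | false | true  | n = n (inj₂ (inj₂ _))

-- Inserting a new last entry

-- The increasing map from ℕ onto the complement of `v`, which makes room for a new entry `v`.
shift : ℕ → ℕ → ℕ
shift zero    x       = suc x
shift (suc v) zero    = zero
shift (suc v) (suc x) = suc (shift v x)

shift-mono : ∀ v x y → (shift v x <ᵇ shift v y) ≡ (x <ᵇ y)
shift-mono zero    x       y       = refl
shift-mono (suc v) zero    zero    = refl
shift-mono (suc v) zero    (suc y) = refl
shift-mono (suc v) (suc x) zero    = refl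
shift-mono (suc v) (suc x) (suc y) = shift-mono v x y

-- A site `w ≤ v` keeps its number and a site `w ≥ v` becomes `suc w`. The site `v` falls under both
-- rules, since the new entry splits it into `v` and `suc v`.
shift-low : ∀ {v w} → w ≤ v → ∀ x → (shift v x <ᵇ w) ≡ (x <ᵇ w)
shift-low {v} {zero} w≤v x = trans (⇒≮ᵇ {shift v x} z≤n) (sym (⇒≮ᵇ {x} z≤n))
shift-low (s≤s w≤v) zero    = refl
shift-low (s≤s w≤v) (suc x) = shift-low w≤v x

shift-high : ∀ {v w} → v ≤ w → ∀ x → (shift v x <ᵇ suc w) ≡ (x <ᵇ w)
shift-high z≤n       x       = refl
shift-high (s≤s v≤w) zero    = refl
shift-high (s≤s v≤w) (suc x) = shift-high v≤w x

shift-injective : ∀ v {x y} → shift v x ≡ shift v y → x ≡ y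
shift-injective zero    {x}     {y}     refl = refl
shift-injective (suc v) {zero}  {zero}  e    = refl
shift-injective (suc v) {suc x} {suc y} e    = cong suc (shift-injective v (ℕ.suc-injective e))

shift-≢ : ∀ v x → shift v x ≢ v
shift-≢ (suc v) (suc x) e = shift-≢ v x (ℕ.suc-injective e)

shift-upper : ∀ {v n x} → x < n → shift v x < suc n
shift-upper {zero}          x<n       = s≤s x<n
shift-upper {suc v} {x = zero}  x<n   = s≤s z≤n
shift-upper {suc v} {x = suc x} (s≤s x<n) = s≤s (shift-upper {v} x<n)

unshift : ∀ v i → i ≢ v → ∃ λ x → i ≡ shift v x
unshift zero    zero    i≢v = ⊥-elim (i≢v refl)
unshift zero    (suc i) i≢v = i , refl
unshift (suc v) zero    i≢v = zero , refl
unshift (suc v) (suc i) i≢v = let x , e = unshift v i (i≢v ∘ cong suc) in suc x , cong suc e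

shift-upper⁻ : ∀ {v n x} → v ≤ n → shift v x < suc n → x < n
shift-upper⁻ {zero}                  v≤n       (s≤s p) = p
shift-upper⁻ {suc v} {x = zero}      (s≤s v≤n) p       = s≤s z≤n
shift-upper⁻ {suc v} {x = suc x}     (s≤s v≤n) (s≤s p) = s≤s (shift-upper⁻ v≤n p)

module _ (f : ℕ → ℕ) where

  siteType-map : ∀ {w w′} → (∀ x → (f x <ᵇ w′) ≡ (x <ᵇ w)) → ∀ r → siteType (map f r) w′ ≡ siteType r w
  siteType-map e []      = refl
  siteType-map {w} {w′} e (x ∷ r) rewrite e x | siteType-map {w} {w′} e r = refl

  noneBetween-map : ∀ {v v′ w w′} → (∀ x → (f x <ᵇ v′) ≡ (x <ᵇ v)) → (∀ x → (f x <ᵇ w′) ≡ (x <ᵇ w)) →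
    ∀ r → noneBetween v′ w′ (map f r) ≡ noneBetween v w r
  noneBetween-map e e′ []      = refl
  noneBetween-map {v} {v′} {w} {w′} e e′ (x ∷ r) = cong₂ _∧_ (cong₂ (λ b c → b ∨ not c) (e x) (e′ x)) (noneBetween-map {v} {v′} {w} {w′} e e′ r)

  admits-map : ∀ {v v′ w w′} → (∀ x → (f x <ᵇ v′) ≡ (x <ᵇ v)) → (∀ x → (f x <ᵇ w′) ≡ (x <ᵇ w)) →
    ∀ t r → admits t (map f r) v′ w′ ≡ admits t r v w
  admits-map e e′ emp r = refl
  admits-map e e′ bot r = refl
  admits-map e e′ top r = refl
  admits-map e e′ ab  r = cong isTop (siteType-map e′ r)
  admits-map {v} {v′} {w} {w′} e e′ ba r = noneBetween-map {v} {v′} {w} {w′} e e′ r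
  admits-map e e′ mix r = refl

  module _ (mono : ∀ x y → (f x <ᵇ f y) ≡ (x <ᵇ y)) where

    active-map : ∀ {w w′} → (∀ x → (f x <ᵇ w′) ≡ (x <ᵇ w)) → ∀ r → active w′ (map f r) ≡ active w r
    active-map e []      = refl
    active-map {w} {w′} e (v ∷ p)
      rewrite e v | siteType-map {v} {f v} (λ x → mono x v) p
            | admits-map {v} {f v} {w} {w′} (λ x → mono x v) e (siteType p v) p | active-map {w} {w′} e p = refl

    avoids-map : ∀ r → avoids (map f r) ≡ avoids r
    avoids-map []      = refl
    avoids-map (v ∷ p) = cong₂ _∧_ (active-map (λ x → mono x v) p) (avoids-map p)

extend : ℕ → List ℕ → List ℕ
extend v r = v ∷ map (shift v) r

avoids-extend : ∀ v r → avoids (extend v r) ≡ active v r ∧ avoids r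
avoids-extend v r = cong₂ _∧_ (active-map (shift v) (shift-mono v) (shift-low (ℕ.≤-refl {v})) r) (avoids-map (shift v) (shift-mono v) r)

siteType-extend-low : ∀ {v w} → w ≤ v → ∀ r → siteType (extend v r) w ≡ high (siteType r w)
siteType-extend-low {v} w≤v r rewrite ⇒≮ᵇ w≤v = cong high (siteType-map (shift v) (shift-low w≤v) r)

siteType-extend-high : ∀ {v w} → v ≤ w → ∀ r → siteType (extend v r) (suc w) ≡ low (siteType r w)
siteType-extend-high {v} {w} v≤w r rewrite ⇒<ᵇ (s≤s v≤w) = cong low (siteType-map (shift v) (shift-high v≤w) r)

active-extend-low : ∀ {v w} → w ≤ v → ∀ r → active w (extend v r) ≡ active w r
active-extend-low {v} w≤v r rewrite ⇒≮ᵇ w≤v = active-map (shift v) (shift-mono v) (shift-low w≤v) r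

active-extend-high : ∀ {v w} → v ≤ w → ∀ r →
  active (suc w) (extend v r) ≡ admits (siteType r v) (map (shift v) r) v (suc w) ∧ active w r
active-extend-high {v} {w} v≤w r
  rewrite ⇒<ᵇ (s≤s v≤w) | siteType-map (shift v) {v} {v} (shift-low (ℕ.≤-refl {v})) r =
  cong (admits (siteType r v) (map (shift v) r) v (suc w) ∧_) (active-map (shift v) (shift-mono v) (shift-high v≤w) r)

sites : List ℕ → ℕ → ℕ → List SiteType
sites r a zero    = []
sites r a (suc k) = if active a r then siteType r a ∷ sites r (suc a) k else sites r (suc a) k

types : List ℕ → List SiteType
types r = sites r 0 (suc (length r))

sites-++ : ∀ r a k l → sites r a (k ℕ.+ l) ≡ sites r a k ++ sites r (a ℕ.+ k) l
sites-++ r a zero    l rewrite ℕ.+-identityʳ a = refl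
sites-++ r a (suc k) l rewrite ℕ.+-suc a k | sites-++ r (suc a) k l with active a r
... | true  = refl
... | false = refl

sites-suc : ∀ r v → sites r 0 (suc v) ≡ sites r 0 v ++ sites r v 1
sites-suc r v = trans (cong (sites r 0) (ℕ.+-comm 1 v)) (sites-++ r 0 v 1)

sites-extend-low : ∀ {v} r a k → a ℕ.+ k ≤ v → sites (extend v r) a k ≡ map high (sites r a k)
sites-extend-low r a zero    p = refl
sites-extend-low {v} r a (suc k) p
  rewrite active-extend-low (ℕ.≤-trans (ℕ.m≤m+n a (suc k)) p) r
        | siteType-extend-low (ℕ.≤-trans (ℕ.m≤m+n a (suc k)) p) r
        | sites-extend-low {v} r (suc a) k (subst (_≤ v) (ℕ.+-suc a k) p)
  with active a r
... | true  = refl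
... | false = refl

sites-extend-high : ∀ {v} r → (∀ w → admits (siteType r v) (map (shift v) r) v (suc w) ≡ true) →
  ∀ a k → v ≤ a → sites (extend v r) (suc a) k ≡ map low (sites r a k)
sites-extend-high     r e a zero    v≤a = refl
sites-extend-high {v} r e a (suc k) v≤a
  rewrite active-extend-high v≤a r | siteType-extend-high v≤a r | e a
        | sites-extend-high {v} r e (suc a) k (ℕ.m≤n⇒m≤1+n v≤a)
  with active a r
... | true  = refl
... | false = refl

sites-extend-ab : ∀ {v} r → siteType r v ≡ ab → ∀ a k → v ≤ a →
  sites (extend v r) (suc a) k ≡ map low (filterᵇ isTop (sites r a k))
sites-extend-ab     r e a zero    v≤a = refl
sites-extend-ab {v} r e a (suc k) v≤a
  rewrite active-extend-high v≤a r | siteType-extend-high v≤a r | e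
        | siteType-map (shift v) {a} {suc a} (shift-high v≤a) r
        | sites-extend-ab {v} r e (suc a) k (ℕ.m≤n⇒m≤1+n v≤a)
  with siteType r a | active a r
... | emp | true  = refl
... | emp | false = refl
... | bot | true  = refl
... | bot | false = refl
... | top | true  = refl
... | top | false = refl
... | ab  | true  = refl
... | ab  | false = refl
... | ba  | true  = refl
... | ba  | false = refl
... | mix | true  = refl
... | mix | false = refl

sites-extend-none : ∀ {v} r a k → v ≤ a →
  (∀ w → a ≤ w → w < a ℕ.+ k → admits (siteType r v) (map (shift v) r) v (suc w) ≡ false) →
  sites (extend v r) (suc a) k ≡ []
sites-extend-none     r a zero    v≤a e = refl
sites-extend-none {v} r a (suc k) v≤a e
  rewrite active-extend-high v≤a r | e a ℕ.≤-refl (ℕ.m<m+n a (s≤s z≤n)) =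
  sites-extend-none {v} r (suc a) k (ℕ.m≤n⇒m≤1+n v≤a)
    (λ w a<w w< → e w (ℕ.<⇒≤ a<w) (subst (w <_) (sym (ℕ.+-suc a k)) w<))

record IsPermutation (n : ℕ) (r : List ℕ) : Set where
  field
    size     : length r ≡ n
    complete : ∀ {i} → i < n → i ∈ r
    bounded  : ∀ {i} → i ∈ r → i < n

open IsPermutation

noneBetween-shift-adjacent : ∀ v r → noneBetween v (suc v) (map (shift v) r) ≡ true
noneBetween-shift-adjacent v r with noneBetween v (suc v) (map (shift v) r) in e
... | true  = refl
... | false with noneBetween-false v (suc v) (map (shift v) r) e
... | x , i , v≤x , s≤s x≤v with ∈.∈-map⁻ (shift v) i
... | y , _ , x≡ = ⊥-elim (shift-≢ v y (trans (sym x≡) (ℕ.≤-antisym x≤v v≤x)))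

shift-self : ∀ v → shift v v ≡ suc v
shift-self zero    = refl
shift-self (suc v) = cong suc (shift-self v)

-- The old entry `v` moves to `suc v` and so separates the new entry from every site above `suc v`.
noneBetween-shift : ∀ {v w r} → v ∈ r → v < w → noneBetween v (suc w) (map (shift v) r) ≡ false
noneBetween-shift {v} {w} {r} i v<w with noneBetween v (suc w) (map (shift v) r) in e
... | false = refl
... | true  = ⊥-elim (noneBetween-true v (suc w) (map (shift v) r) e
  (subst (_∈ map (shift v) r) (shift-self v) (∈.∈-map⁺ (shift v) i)) (ℕ.n≤1+n v) (s≤s v<w))

-- The window is longer by two than the list of higher sites because both halves of the site `v`
-- belong to it. In the case `ba`, completeness of the permutation supplies the old entry `v` that
-- blocks all sites above the upper half.
sites-extend-grow : ∀ {v l} r → IsPermutation (v ℕ.+ l) r → active v r ≡ true →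
  sites (extend v r) v (suc (suc l)) ≡ grow (siteType r v) (sites r (suc v) l)
sites-extend-grow {v} {l} r perm act
  rewrite active-extend-low (ℕ.≤-refl {v}) r | act | siteType-extend-low (ℕ.≤-refl {v}) r
  with siteType r v in t
... | emp = cong (bot ∷_) (trans (sites-extend-high r (λ w → cong (λ s → admits s (map (shift v) r) v (suc w)) t) v (suc l) ℕ.≤-refl) first)
  where
  first : map low (sites r v (suc l)) ≡ map low (emp ∷ sites r (suc v) l)
  first rewrite act | t = refl
... | bot = cong (bot ∷_) (trans (sites-extend-high r (λ w → cong (λ s → admits s (map (shift v) r) v (suc w)) t) v (suc l) ℕ.≤-refl) first)
  where
  first : map low (sites r v (suc l)) ≡ map low (bot ∷ sites r (suc v) l)
  first rewrite act | t = refl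
... | top = cong (ba ∷_) (trans (sites-extend-high r (λ w → cong (λ s → admits s (map (shift v) r) v (suc w)) t) v (suc l) ℕ.≤-refl) first)
  where
  first : map low (sites r v (suc l)) ≡ map low (top ∷ sites r (suc v) l)
  first rewrite act | t = refl
... | ab = cong (mix ∷_) (trans (sites-extend-ab r t v (suc l) ℕ.≤-refl) first)
  where
  first : map low (filterᵇ isTop (sites r v (suc l))) ≡ map low (filterᵇ isTop (sites r (suc v) l))
  first rewrite act | t = refl
... | ba = cong (ba ∷_) second
  where
  second : sites (extend v r) (suc v) (suc l) ≡ mix ∷ []
  second rewrite active-extend-high (ℕ.≤-refl {v}) r | siteType-extend-high (ℕ.≤-refl {v}) r | t | act
               | noneBetween-shift-adjacent v r =
    cong (mix ∷_) (sites-extend-none r (suc v) l (ℕ.n≤1+n v) λ w v<w w< →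
      trans (cong (λ s → admits s (map (shift v) r) v (suc w)) t)
        (noneBetween-shift (complete perm (ℕ.<-≤-trans v<w (ℕ.≤-pred w<))) v<w))
... | mix = cong (mix ∷_) (sites-extend-none r v (suc l) ℕ.≤-refl λ w _ _ →
      cong (λ s → admits s (map (shift v) r) v (suc w)) t)

types-extend : ∀ {v l} r → IsPermutation (v ℕ.+ l) r → active v r ≡ true →
  types (extend v r) ≡ map high (sites r 0 v) ++ grow (siteType r v) (sites r (suc v) l)
types-extend {v} {l} r perm act =
  trans (cong (sites (extend v r) 0) len)
    (trans (sites-++ (extend v r) 0 v (suc (suc l)))
      (cong₂ _++_ (sites-extend-low r 0 v ℕ.≤-refl) (sites-extend-grow r perm act)))
  where
  len : suc (length (extend v r)) ≡ v ℕ.+ suc (suc l)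
  len rewrite List.length-map (shift v) r | size perm | ℕ.+-suc v (suc l) | ℕ.+-suc v l = refl

-- Children of a permutation and their site types

childrenFrom : List ℕ → ℕ → ℕ → List (List ℕ)
childrenFrom r a zero    = []
childrenFrom r a (suc k) = if active a r then extend a r ∷ childrenFrom r (suc a) k else childrenFrom r (suc a) k

children : List ℕ → List (List ℕ)
children r = childrenFrom r 0 (suc (length r))

sumOver : ∀ {A : Set} → (A → ℤ) → List A → ℤ
sumOver f []       = + 0
sumOver f (x ∷ xs) = f x + sumOver f xs

total-childrenFrom : ∀ f r k v → IsPermutation (length r) r → v ℕ.+ k ≡ suc (length r) →
  total f (sites r 0 v) (sites r v k) ≡ sumOver (λ s → f (types s)) (childrenFrom r v k)
total-childrenFrom f r zero    v perm e = refl
total-childrenFrom f r (suc k) v perm e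
  with active v r in act | total-childrenFrom f r k (suc v) perm (trans (sym (ℕ.+-suc v k)) e)
... | true  | ih = cong₂ (λ x y → f x + y)
  (sym (types-extend r (subst (λ n → IsPermutation n r) (ℕ.suc-injective (trans (sym e) (ℕ.+-suc v k))) perm) act))
  (trans (cong (λ us → total f us (sites r (suc v) k)) (sym snoc)) ih)
  where
  snoc : sites r 0 (suc v) ≡ sites r 0 v ++ siteType r v ∷ []
  snoc = trans (sites-suc r v) (cong (λ b → sites r 0 v ++ (if b then siteType r v ∷ [] else [])) act)
... | false | ih = trans (cong (λ us → total f us (sites r (suc v) k)) (sym snoc)) ih
  where
  snoc : sites r 0 (suc v) ≡ sites r 0 v
  snoc = trans (sites-suc r v)
    (trans (cong (λ b → sites r 0 v ++ (if b then siteType r v ∷ [] else [])) act) (List.++-identityʳ _))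

total-children : ∀ f r → IsPermutation (length r) r → total f [] (types r) ≡ sumOver (λ s → f (types s)) (children r)
total-children f r perm = total-childrenFrom f r (suc (length r)) 0 perm refl

-- Enumeration of the class

module _ {A : Set} where

  unique-⊆-length : ∀ {xs ys : List A} → Unique xs → (∀ {x} → x ∈ xs → x ∈ ys) → length xs ≤ length ys
  unique-⊆-length {[]}     u        sub = z≤n
  unique-⊆-length {x ∷ xs} (x∉ ∷ u) sub with ∈.∈-∃++ (sub (here refl))
  ... | us , vs , refl = ℕ.≤-trans (s≤s (unique-⊆-length u rest)) (ℕ.≤-reflexive len)
    where
    len : suc (length (us ++ vs)) ≡ length (us ++ x ∷ vs)
    len rewrite List.length-++ us {vs} | List.length-++ us {x ∷ vs} = sym (ℕ.+-suc (length us) (length vs))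
    rest : ∀ {y} → y ∈ xs → y ∈ us ++ vs
    rest i with ∈.∈-++⁻ us (sub (there i))
    ... | inj₁ j           = ∈.∈-++⁺ˡ j
    ... | inj₂ (here refl) = ⊥-elim (All.lookup x∉ i refl)
    ... | inj₂ (there j)   = ∈.∈-++⁺ʳ us j

  unique-concatMap : ∀ {B : Set} (f : B → List A) {xs} → Unique xs → (∀ x → Unique (f x)) →
    (∀ {x y s} → s ∈ f x → s ∈ f y → x ≡ y) → Unique (concatMap f xs)
  unique-concatMap f {[]}     u        uf inj = []
  unique-concatMap f {x ∷ xs} (x∉ ∷ u) uf inj = Unique.++⁺ (uf x) (unique-concatMap f u uf inj) λ (i , j) →
    let y , y∈xs , s∈fy = find (∈.∈-concatMap⁻ f {xs = xs} j) in All.lookup x∉ y∈xs (inj i s∈fy)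

upTo-⊆⇒≤ : ∀ n {r} → (∀ {i} → i < n → i ∈ r) → n ≤ length r
upTo-⊆⇒≤ n {r} sub = subst (_≤ length r) (List.length-upTo n)
  (unique-⊆-length (Unique.upTo⁺ n) (sub ∘ ∈.∈-upTo⁻))

unshift-list : ∀ v p → v ∉ p → ∃ λ r → p ≡ map (shift v) r
unshift-list v []      v∉p = [] , refl
unshift-list v (x ∷ p) v∉p with unshift v x (λ e → v∉p (here (sym e))) | unshift-list v p (v∉p ∘ there)
... | y , refl | r , refl = y ∷ r , refl

extend-permutation : ∀ {n v r} → v ≤ n → IsPermutation n r → IsPermutation (suc n) (extend v r)
extend-permutation {n} {v} {r} v≤n perm = record
  { size = cong suc (trans (List.length-map (shift v) r) (size perm))
  ; complete = occurs
  ; bounded = bound }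
  where
  occurs : ∀ {i} → i < suc n → i ∈ extend v r
  occurs {i} i≤n with i ℕ.≟ v
  ... | yes refl = here refl
  ... | no i≢v with unshift v i i≢v
  ... | x , refl = there (∈.∈-map⁺ (shift v) (complete perm (shift-upper⁻ v≤n i≤n)))
  bound : ∀ {i} → i ∈ extend v r → i < suc n
  bound (here refl) = s≤s v≤n
  bound (there i) with ∈.∈-map⁻ (shift v) i
  ... | x , j , refl = shift-upper {v} (bounded perm j)

-- Pigeonhole: if the head recurred, the `n` entries of the tail would take `suc n` values.
permutation-head-∉ : ∀ {n v p} → IsPermutation (suc n) (v ∷ p) → v ∉ p
permutation-head-∉ {n} {v} {p} perm v∈p = ℕ.<⇒≱ (ℕ.n<1+n n)
  (subst (suc n ≤_) (ℕ.suc-injective (size perm)) (upTo-⊆⇒≤ (suc n) sub))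
  where
  sub : ∀ {i} → i < suc n → i ∈ p
  sub i≤n with complete perm i≤n
  ... | here refl = v∈p
  ... | there j   = j

retract-permutation : ∀ {n v p} → IsPermutation (suc n) (v ∷ p) → ∃ λ r → v ∷ p ≡ extend v r × IsPermutation n r
retract-permutation {n} {v} {p} perm with unshift-list v p (permutation-head-∉ perm)
... | r , refl = r , refl , record
  { size = trans (sym (List.length-map (shift v) r)) (ℕ.suc-injective (size perm))
  ; complete = occurs
  ; bounded = λ i → shift-upper⁻ (ℕ.≤-pred (bounded perm (here refl))) (bounded perm (there (∈.∈-map⁺ (shift v) i))) }
  where
  occurs : ∀ {i} → i < n → i ∈ r
  occurs {i} i<n with complete perm (shift-upper {v} i<n)
  ... | here e  = ⊥-elim (shift-≢ v i e)
  ... | there j with ∈.∈-map⁻ (shift v) j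
  ... | y , k , e = subst (_∈ r) (sym (shift-injective v e)) k

permutation-unique : ∀ n {r} → IsPermutation n r → Unique r
permutation-unique n       {[]}    perm = []
permutation-unique zero    {v ∷ p} perm with size perm
... | ()
permutation-unique (suc n) {v ∷ p} perm with retract-permutation perm
... | r , refl , perm′ =
  All.tabulate (λ i e → permutation-head-∉ perm (subst (_∈ p) (sym e) i)) ∷
  Unique.map⁺ (shift-injective v) (permutation-unique n perm′)

reverse-permutation : ∀ {n r} → IsPermutation n r → IsPermutation n (reverse r)
reverse-permutation {n} {r} perm = record
  { size = trans (List.length-reverse r) (size perm)
  ; complete = λ i → Any.reverse⁺ (complete perm i)
  ; bounded = λ i → bounded perm (Any.reverse⁻ i) }

∈-childrenFrom⁻ : ∀ {s} r a k → s ∈ childrenFrom r a k →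
  ∃ λ v → a ≤ v × v < a ℕ.+ k × active v r ≡ true × s ≡ extend v r
∈-childrenFrom⁻ r a (suc k) i with active a r in e | i
... | true | here refl = a , ℕ.≤-refl , ℕ.m<m+n a (s≤s z≤n) , e , refl
... | true | there j   = let v , p , q , s = ∈-childrenFrom⁻ r (suc a) k j in
  v , ℕ.<⇒≤ p , subst (v <_) (sym (ℕ.+-suc a k)) q , s
... | false | j        = let v , p , q , s = ∈-childrenFrom⁻ r (suc a) k j in
  v , ℕ.<⇒≤ p , subst (v <_) (sym (ℕ.+-suc a k)) q , s

∈-childrenFrom⁺ : ∀ {v} r a k → a ≤ v → v < a ℕ.+ k → active v r ≡ true → extend v r ∈ childrenFrom r a k
∈-childrenFrom⁺ {v} r a zero a≤v v< act = ⊥-elim (ℕ.<⇒≱ (subst (v <_) (ℕ.+-identityʳ a) v<) a≤v)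
∈-childrenFrom⁺ {v} r a (suc k) a≤v v< act with a ℕ.≟ v
... | yes refl rewrite act = here refl
... | no a≢v with active a r | ∈-childrenFrom⁺ r (suc a) k (ℕ.≤∧≢⇒< a≤v a≢v) (subst (v <_) (ℕ.+-suc a k) v<) act
... | true  | i = there i
... | false | i = i

extend-injective : ∀ {v v′ r r′} → extend v r ≡ extend v′ r′ → r ≡ r′
extend-injective {v} e with List.∷-injective e
... | refl , e′ = List.map-injective (shift-injective v) e′

unique-childrenFrom : ∀ r a k → Unique (childrenFrom r a k)
unique-childrenFrom r a zero    = []
unique-childrenFrom r a (suc k) with active a r
... | false = unique-childrenFrom r (suc a) k
... | true  = All.tabulate distinct ∷ unique-childrenFrom r (suc a) k
  where
  distinct : ∀ {s} → s ∈ childrenFrom r (suc a) k → extend a r ≢ s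
  distinct i refl with ∈-childrenFrom⁻ r (suc a) k i
  ... | v , a<v , _ , _ , e = ℕ.<⇒≢ a<v (List.∷-injectiveˡ e)

nodes : ℕ → List (List ℕ)
nodes zero    = [] ∷ []
nodes (suc n) = concatMap children (nodes n)

nodes-unique : ∀ n → Unique (nodes n)
nodes-unique zero    = [] ∷ []
nodes-unique (suc n) = unique-concatMap children (nodes-unique n) (λ r → unique-childrenFrom r 0 (suc (length r)))
  λ {r} {r′} i j →
    let _ , _ , _ , _ , e  = ∈-childrenFrom⁻ r 0 (suc (length r)) i
        _ , _ , _ , _ , e′ = ∈-childrenFrom⁻ r′ 0 (suc (length r′)) j
    in extend-injective (trans (sym e) e′)

nodes-sound : ∀ n {s} → s ∈ nodes n → IsPermutation n s × avoids s ≡ true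
nodes-sound zero    (here refl) = record { size = refl ; complete = λ () ; bounded = λ () } , refl
nodes-sound (suc n) i with find (∈.∈-concatMap⁻ children {xs = nodes n} i)
... | r , r∈ , j with nodes-sound n r∈ | ∈-childrenFrom⁻ r 0 (suc (length r)) j
... | perm , av | v , _ , s≤s v≤ , act , refl =
  extend-permutation (subst (v ≤_) (size perm) v≤) perm ,
  trans (avoids-extend v r) (cong₂ _∧_ act av)

∧-split : ∀ {b c} → b ∧ c ≡ true → b ≡ true × c ≡ true
∧-split {true} {true} e = refl , refl

nodes-complete : ∀ n {s} → IsPermutation n s → avoids s ≡ true → s ∈ nodes n
nodes-complete zero    {[]}    perm av = here refl
nodes-complete zero    {v ∷ p} perm av with size perm
... | ()
nodes-complete (suc n) {[]}    perm av with size perm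
... | ()
nodes-complete (suc n) {v ∷ p} perm av with retract-permutation perm
... | r , refl , perm′ with ∧-split (trans (sym (avoids-extend v r)) av)
... | act , av′ = ∈.∈-concatMap⁺ children (lose (nodes-complete n perm′ av′)
  (∈-childrenFrom⁺ r 0 (suc (length r)) z≤n (subst (λ m → v < suc m) (sym (size perm′)) (bounded perm (here refl))) act))

module _ {A : Set} where

  sumOver-cong : ∀ {f g : A → ℤ} xs → (∀ {x} → x ∈ xs → f x ≡ g x) → sumOver f xs ≡ sumOver g xs
  sumOver-cong []       e = refl
  sumOver-cong (x ∷ xs) e = cong₂ _+_ (e (here refl)) (sumOver-cong xs (e ∘ there))

  sumOver-++ : ∀ (f : A → ℤ) xs ys → sumOver f (xs ++ ys) ≡ sumOver f xs + sumOver f ys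
  sumOver-++ f []       ys = sym (ℤ.+-identityˡ _)
  sumOver-++ f (x ∷ xs) ys = trans (cong (λ y → f x + y) (sumOver-++ f xs ys)) (sym (ℤ.+-assoc (f x) _ _))

  sumOver-concatMap : ∀ {B : Set} (f : A → ℤ) (g : B → List A) xs →
    sumOver f (concatMap g xs) ≡ sumOver (λ x → sumOver f (g x)) xs
  sumOver-concatMap f g []       = refl
  sumOver-concatMap f g (x ∷ xs) = trans (sumOver-++ f (g x) (concatMap g xs))
    (cong (λ y → sumOver f (g x) + y) (sumOver-concatMap f g xs))

  sumOver-one : ∀ (xs : List A) → sumOver (λ _ → + 1) xs ≡ + length xs
  sumOver-one []       = refl
  sumOver-one (x ∷ xs) = cong (λ y → + 1 + y) (sumOver-one xs)

-- The induction on `n` trades a level of nodes for one more level of descendants, which is why `m`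
-- is general; for `m = 0` the sum counts the nodes.
sumOver-nodes : ∀ n m → sumOver (λ r → cnt (types r) m) (nodes n) ≡ cnt (emp ∷ []) (n ℕ.+ m)
sumOver-nodes zero    m = ℤ.+-identityʳ _
sumOver-nodes (suc n) m = begin
  sumOver (λ r → cnt (types r) m) (nodes (suc n))
    ≡⟨ sumOver-concatMap (λ r → cnt (types r) m) children (nodes n) ⟩
  sumOver (λ r → sumOver (λ s → cnt (types s) m) (children r)) (nodes n)
    ≡⟨ sumOver-cong (nodes n) (λ {r} i → total-children (λ us → cnt us m) r (perm i)) ⟨
  sumOver (λ r → cnt (types r) (suc m)) (nodes n)
    ≡⟨ sumOver-nodes n (suc m) ⟩
  cnt (emp ∷ []) (n ℕ.+ suc m)
    ≡⟨ cong (cnt (emp ∷ [])) (ℕ.+-suc n m) ⟩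
  cnt (emp ∷ []) (suc n ℕ.+ m) ∎
  where
  open ≡-Reasoning
  perm : ∀ {r} → r ∈ nodes n → IsPermutation (length r) r
  perm {r} i = let p = proj₁ (nodes-sound n i) in subst (λ k → IsPermutation k r) (sym (size p)) p

length-nodes : ∀ n → + length (nodes n) ≡ cnt (emp ∷ []) n
length-nodes n = trans (sym (sumOver-one (nodes n)))
  (trans (sumOver-nodes n 0) (cong (cnt (emp ∷ [])) (ℕ.+-identityʳ n)))

words-unique : ∀ k m → Unique (words k m)
words-unique k zero    = [] ∷ []
words-unique k (suc m) = unique-concatMap (λ x → map (x ∷_) (words k m)) (Unique.upTo⁺ k)
  (λ x → Unique.map⁺ List.∷-injectiveʳ (words-unique k m))
  λ i j → same (∈.∈-map⁻ _ i) (∈.∈-map⁻ _ j)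
  where
  same : ∀ {x y s} → (∃ λ w → w ∈ words k m × s ≡ x ∷ w) → (∃ λ w → w ∈ words k m × s ≡ y ∷ w) → x ≡ y
  same (_ , _ , refl) (_ , _ , refl) = refl

∈-words⁻ : ∀ k m {w} → w ∈ words k m → length w ≡ m × (∀ {i} → i ∈ w → i < k)
∈-words⁻ k zero    (here refl) = refl , λ ()
∈-words⁻ k (suc m) i with find (∈.∈-concatMap⁻ (λ x → map (x ∷_) (words k m)) {xs = upTo k} i)
... | x , x∈ , j with ∈.∈-map⁻ (x ∷_) j
... | w , l , refl with ∈-words⁻ k m l
... | len , bound = cong suc len , λ { (here refl) → ∈.∈-upTo⁻ x∈ ; (there p) → bound p }

∈-words⁺ : ∀ k m {w} → length w ≡ m → (∀ {i} → i ∈ w → i < k) → w ∈ words k m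
∈-words⁺ k zero    {[]}    len  bound = here refl
∈-words⁺ k (suc m) {x ∷ w} len bound = ∈.∈-concatMap⁺ (λ x → map (x ∷_) (words k m))
  (lose (∈.∈-upTo⁺ (bound (here refl)))
    (∈.∈-map⁺ (x ∷_) (∈-words⁺ k m (ℕ.suc-injective len) (bound ∘ there))))

∈-perms⁻ : ∀ n {w} → w ∈ perms n → IsPermutation n w
∈-perms⁻ n {w} i with ∈.∈-filter⁻ (λ w → T? (isPerm n w)) {xs = words n n} i
... | w∈ , t = record
  { size = proj₁ (∈-words⁻ n n w∈)
  ; complete = λ {j} j<n → occurs (All.lookup (Allₚ.all⁺ (λ i → elem i w) (upTo n) t) (∈.∈-upTo⁺ j<n))
  ; bounded = proj₂ (∈-words⁻ n n w∈) }
  where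
  occurs : ∀ {j} → T (elem j w) → j ∈ w
  occurs {j} t with find (Any.any⁻ (λ y → j ℕ.≡ᵇ y) w t)
  ... | y , y∈ , e = subst (_∈ w) (sym (ℕ.≡ᵇ⇒≡ j y e)) y∈

∈-perms⁺ : ∀ n {w} → IsPermutation n w → w ∈ perms n
∈-perms⁺ n {w} perm = ∈.∈-filter⁺ (λ w → T? (isPerm n w)) (∈-words⁺ n n (size perm) (bounded perm))
  (Allₚ.all⁻ (λ i → elem i w) (All.tabulate λ {j} i → Any.any⁺ _ (lose (complete perm (∈.∈-upTo⁻ i)) (ℕ.≡⇒≡ᵇ j j refl))))

-- Both lists are free of duplicates and reversal carries each into the other, so inclusion in the
-- two directions bounds each length by the other.
countAv-nodes : ∀ n → countAv basis n ≡ length (nodes n)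
countAv-nodes n = ℕ.≤-antisym
  (ℕ.≤-trans (unique-⊆-length (Unique.filter⁺ _ (Unique.filter⁺ _ (words-unique n n))) to)
             (ℕ.≤-reflexive (List.length-map reverse (nodes n))))
  (ℕ.≤-trans (ℕ.≤-reflexive (sym (List.length-map reverse (nodes n))))
             (unique-⊆-length (Unique.map⁺ List.reverse-injective (nodes-unique n)) from))
  where
  avoiders = filter (λ σ → T? (avoidsAll basis σ)) (perms n)
  to : ∀ {σ} → σ ∈ avoiders → σ ∈ map reverse (nodes n)
  to {σ} i with ∈.∈-filter⁻ (λ σ → T? (avoidsAll basis σ)) {xs = perms n} i
  ... | σ∈ , t = subst (_∈ map reverse (nodes n)) (List.reverse-involutive σ)
    (∈.∈-map⁺ reverse (nodes-complete n perm (avoidsAll⇒avoids (reverse σ) (permutation-unique n perm)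
      (subst (λ σ → T (avoidsAll basis σ)) (sym (List.reverse-involutive σ)) t))))
    where perm = reverse-permutation (∈-perms⁻ n σ∈)
  from : ∀ {σ} → σ ∈ map reverse (nodes n) → σ ∈ avoiders
  from i with ∈.∈-map⁻ reverse i
  ... | r , r∈ , refl with nodes-sound n r∈
  ... | perm , av = ∈.∈-filter⁺ (λ σ → T? (avoidsAll basis σ)) (∈-perms⁺ n (reverse-permutation perm)) (avoids⇒avoidsAll r av)

H-eq : H ≋ 1ₛ ⊕ z ⊛ valU 0 0
H-eq n = trans (cong +_ (countAv-nodes n)) (trans (length-nodes n) (cnt-root n))

-- The closed form

-- Since ℤ has no zero divisors, `f 0` vanishes; then `tail f ⊛ g` vanishes too, and the argument
-- repeats at the next coefficient.
⊛-zero-product : ∀ f g → ¬ g 0 ≡ + 0 → f ⊛ g ≋ 0ₛ → f ≋ 0ₛ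
⊛-zero-product f g g0 p = λ n → trans (coeff n f p) (sym (0ₛ-coeff n))
  where
  head-zero : ∀ f → f ⊛ g ≋ 0ₛ → f 0 ≡ + 0
  head-zero f p with ℤ.i*j≡0⇒i≡0∨j≡0 (f 0) (p 0)
  ... | inj₁ f0 = f0
  ... | inj₂ e  = ⊥-elim (g0 e)
  coeff : ∀ n f → f ⊛ g ≋ 0ₛ → f n ≡ + 0
  coeff zero    f p = head-zero f p
  coeff (suc n) f p = coeff n (tail f) λ m → begin
    (tail f ⊛ g) m                      ≡⟨ ℤ.+-identityˡ _ ⟨
    + 0 + (tail f ⊛ g) m                ≡⟨ cong (λ x → x * g (suc m) + (tail f ⊛ g) m) (head-zero f p) ⟨
    f 0 * g (suc m) + (tail f ⊛ g) m    ≡⟨ ⊛-sucˡ f g m ⟨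
    (f ⊛ g) (suc m)                     ≡⟨ p (suc m) ⟩
    + 0                                 ≡⟨ 0ₛ-coeff m ⟨
    0ₛ m                                ∎
    where open ≡-Reasoning

-- The form of a polynomial as an expression in `z` that the ring solver can read.
horner : List ℤ → Series
horner []       = 0ₛ
horner (c ∷ cs) = con c ⊕ z ⊛ horner cs

poly-horner : ∀ cs → poly cs ≋ horner cs
poly-horner []       n       = sym (0ₛ-coeff n)
poly-horner (c ∷ cs) zero    = sym (ℤ.+-identityʳ c)
poly-horner (c ∷ cs) (suc n) = trans (poly-horner cs n)
  (sym (trans (ℤ.+-identityˡ _) (z-⊛-suc (horner cs) n)))

-- The difference of the two roots times their sum is zero, and the sum has constant term 2.
sqrt-unique : ∀ S → S 0 ≡ + 1 → S ⊛ S ≋ poly (+ 1 ∷ - (+ 4) ∷ []) → S ≋ √1-4z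
sqrt-unique S S0 S² =
  solve 2 (λ s t → s := t :+ κ (+ 1) :* ((s :- t) :- κ (+ 0))) ≋-refl S √1-4z
  ⨾ ⊕-vanish _ (⊛-zero-product (S ⊖ √1-4z) (S ⊕ √1-4z) nonzero
      (solve 3 (λ z s t → let e = κ (+ 1) :+ z :* (κ (- (+ 4)) :+ z :* κ (+ 0)) in
          (s :- t) :* (s :+ t) := κ (+ 0) :+ κ (+ 1) :* (s :* s :- e) :+ κ (- (+ 1)) :* (t :* t :- (κ (+ 1) :- κ (+ 4) :* z)))
        ≋-refl z S √1-4z
       ⨾ ⊕-vanish _ √1-4z-squared ⨾ ⊕-vanish _ (S² ⨾ poly-horner (+ 1 ∷ - (+ 4) ∷ []))))
  where
  nonzero : ¬ S 0 + √1-4z 0 ≡ + 0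
  nonzero e with trans (sym (cong (λ x → x + + 1) S0)) e
  ... | ()

Q : Series
Q = horner (+ 1 ∷ - (+ 3) ∷ + 1 ∷ [])

-- `Q` is the reciprocal of `q`, so each factor `Q` of the cleared denominator removes one `q` from
-- `b` or `γ`.
Q⊛b : Q ⊛ b ≋ (1ₛ ⊖ z) ⊛ (C ⊖ 1ₛ) ⊛ (C ⊖ 1ₛ)
Q⊛b = solve 3 (λ z q e → let o = κ (+ 1) in
    (o :+ z :* (κ (- (+ 3)) :+ z :* (o :+ z :* κ (+ 0)))) :* (q :* (o :- z) :* e :* e) :=
    (o :- z) :* e :* e :+ ((o :- z) :* e :* e) :* (q :- (κ (+ 1) :+ z :* (κ (+ 3) :* q :- z :* q))))
    ≋-refl z q (C ⊖ 1ₛ)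
  ⨾ ⊕-vanish _ q-eq

Q⊛γ : Q ⊛ γ ≋ z ⊛ (1ₛ ⊖ z) ⊛ (C ⊖ 1ₛ) ⊛ δ
Q⊛γ = solve 4 (λ z q e d → let o = κ (+ 1) in
    (o :+ z :* (κ (- (+ 3)) :+ z :* (o :+ z :* κ (+ 0)))) :* (q :* z :* (o :- z) :* e :* d) :=
    z :* (o :- z) :* e :* d :+ (z :* (o :- z) :* e :* d) :* (q :- (κ (+ 1) :+ z :* (κ (+ 3) :* q :- z :* q))))
    ≋-refl z q (C ⊖ 1ₛ) δ
  ⨾ ⊕-vanish _ q-eq

closed-form : horner (+ 2 ∷ []) ⊛ √1-4z ⊛ Q ⊛ Q ⊛ (1ₛ ⊕ z ⊛ valU 0 0) ≋
  horner (+ 3 ∷ - (+ 22) ∷ + 54 ∷ - (+ 54) ∷ + 25 ∷ - (+ 4) ∷ [])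
    ⊖ horner (+ 1 ∷ - (+ 6) ∷ + 14 ∷ - (+ 16) ∷ + 5 ∷ []) ⊛ √1-4z
closed-form = solve 6 (λ z c g d b l →
    let o = κ (+ 1)
        q = o :+ z :* (κ (- (+ 3)) :+ z :* (o :+ z :* κ (+ 0)))
        t = o :- κ (+ 2) :* z :* c
        -- The factor of `δ` in `Q ⊛ (γ ⊕ δ)` once `γ` has been expressed by `δ`.
        w = q :+ z :* (o :- z) :* (c :- o)
    in
    (κ (+ 2) :+ z :* κ (+ 0)) :* t :* q :* q :* (o :+ z :*
      (o :* o :* c :+ g :+ d :* (o :* o) :+ l :* κ (+ 0) :+ d :* (o :- o))) :=
    ((κ (+ 3) :+ z :* (κ (- (+ 22)) :+ z :* (κ (+ 54) :+ z :* (κ (- (+ 54)) :+ z :* (κ (+ 25) :+ z :* (κ (- (+ 4)) :+ z :* κ (+ 0)))))))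
     :- (o :+ z :* (κ (- (+ 6)) :+ z :* (κ (+ 14) :+ z :* (κ (- (+ 16)) :+ z :* (κ (+ 5) :+ z :* κ (+ 0)))))) :* t)
    -- After the elimination of `γ`, `δ` and `b` by the last three terms, the difference of the two
    -- sides is a polynomial in `z` and `C`; this is its quotient by C - 1 - z C².
    :+ (:- (z :* (c :* (κ (+ 4) :* z :+ κ (- (+ 12)) :* z :* z :+ κ (+ 10) :* z :* z :* z :+ κ (- (+ 2)) :* z :* z :* z :* z)
          :+ (κ (+ 4) :+ κ (- (+ 16)) :* z :+ κ (+ 16) :* z :* z :+ κ (- (+ 6)) :* z :* z :* z))))
       :* (c :- (o :+ z :* (c :* c)))
    :+ (κ (+ 2) :* z :* z :* w) :* (q :* b :- (o :- z) :* (c :- o) :* (c :- o))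
    :+ (κ (+ 2) :* q :* z :* w) :* (d :- z :* (κ (+ 2) :* c :* d :+ c :* c :+ b))
    :+ (κ (+ 2) :* t :* q :* z) :* (q :* g :- z :* (o :- z) :* (c :- o) :* d))
    ≋-refl z C γ δ b λₛ
  ⨾ ⊕-vanish _ Q⊛γ ⨾ ⊕-vanish _ δ-eq ⨾ ⊕-vanish _ Q⊛b ⨾ ⊕-vanish _ C-eq

theorem2p6 : (S : Series) → S 0 ≡ + 1 → S ⊛ S ≋ poly (+ 1 ∷ - (+ 4) ∷ []) →
    poly (+ 2 ∷ []) ⊛ S ⊛ poly (+ 1 ∷ - (+ 3) ∷ + 1 ∷ []) ⊛ poly (+ 1 ∷ - (+ 3) ∷ + 1 ∷ []) ⊛ H
    ≋ poly (+ 3 ∷ - (+ 22) ∷ + 54 ∷ - (+ 54) ∷ + 25 ∷ - (+ 4) ∷ [])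
    ⊖ poly (+ 1 ∷ - (+ 6) ∷ + 14 ∷ - (+ 16) ∷ + 5 ∷ []) ⊛ S
theorem2p6 S S0 S² =
  ⊛-cong (⊛-cong (⊛-cong (⊛-cong (poly-horner (+ 2 ∷ [])) S≋√1-4z) (poly-horner Qs)) (poly-horner Qs)) H-eq
  ⨾ closed-form
  ⨾ λ n → sym (cong₂ _-_ (poly-horner As n) (⊛-cong (poly-horner Bs) S≋√1-4z n))
  where
  S≋√1-4z = sqrt-unique S S0 S²
  Qs = + 1 ∷ - (+ 3) ∷ + 1 ∷ []
  As = + 3 ∷ - (+ 22) ∷ + 54 ∷ - (+ 54) ∷ + 25 ∷ - (+ 4) ∷ []
  Bs = + 1 ∷ - (+ 6) ∷ + 14 ∷ - (+ 16) ∷ + 5 ∷ []
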